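{- Let $q,d\geq 2$ be integers. Suppose that for every $\mathbf{s}\in(\mathbb{Z}/d\mathbb{Z})^5$ the density $\delta(q,d;\mathbf{s})$ exists, and let $\boldsymbol{\delta}$ be the column vector $(\delta(q,d;\mathbf{s}))_{\mathbf{s}\in(\mathbb{Z}/d\mathbb{Z})^5}$. Then $P(q,d)\boldsymbol{\delta}=\boldsymbol{\delta}$ (i.e., $\boldsymbol{\delta}$ is a right eigenvector of $P(q,d)$ with eigenvalue $1$), and all entries of $\boldsymbol{\delta}$ are rational numbers.
   Context: For an integer $q\geq 2$ and $n\in\mathbb{N}$: $v_q(0)=0$ and, for $n>0$, $v_q(n)=\max\{k: q^k\mid n\}$; $w_q(n)=\sum_{i=0}^n v_q(i)$; $u_q(n)=\sum_{i=0}^n w_q(i)$. For $\mathbf{s}=(\theta_u,\theta_w,\theta_2,\theta_1,\theta_0)$ with entries in $\mathbb{Z}$ (or in $\mathbb{Z}/d\mathbb{Z}$, which is equivalent since only residues mod $d$ matter), $\gamma(A,q,d;\mathbf{s})$ is the number of $n\in\mathbb{N}$, $n<A$, with $\theta_u u_q(n)+\theta_w w_q(n)+\theta_2\frac{n(n+1)}{2}+\theta_1 n+\theta_0\equiv 0\pmod d$, and $\delta(q,d;\mathbf{s})=\lim_{N\to\infty}\gamma(N,q,d;\mathbf{s})/N$ when this limit exists. For $\lambda\in\{0,\ldots,q-1\}$ let $M_\lambda$ be the $5\times5$ matrix, reduced modulo $d$, $$M_\lambda=\begin{pmatrix} q & \lambda-q+1 & q & \lambda-q+1 & 0\\ 0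 & 1 & 0 & 1 & 0\\ 0 & 0 & q^2 & \lambda q-\frac{q(q-1)}{2} & \frac{\lambda(\lambda+1)}{2}\\ 0 & 0 & 0 & q & \lambda\\ 0 & 0 & 0 & 0 & 1 \end{pmatrix}.$$ For $\mathbf{s},\mathbf{t}\in(\mathbb{Z}/d\mathbb{Z})^5$ (row vectors), let $\mu(\mathbf{s},\mathbf{t})$ be the number of $\lambda\in\{0,\ldots,q-1\}$ with $\mathbf{t}=\mathbf{s}M_\lambda$. Then $P(q,d)$ is the $d^5\times d^5$ matrix indexed by $(\mathbb{Z}/d\mathbb{Z})^5$ with $(\mathbf{s},\mathbf{t})$-entry $\mu(\mathbf{s},\mathbf{t})/q$. -}

module Defs where

open import Data.Nat as ℕ using (ℕ; zero; suc; NonZero)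
import Data.Nat.Properties as ℕₚ
open import Data.Nat.Divisibility as ℕ∣ using ()
open import Data.Integer as ℤ using (ℤ; +_)
open import Data.Integer.Divisibility.Signed as ℤ∣ using ()
import Data.Integer.DivMod as ℤDM
open import Data.Rational as ℚ using (ℚ; 0ℚ; 1ℚ; ½)
import Data.Rational.Properties as ℚₚ
open import Data.Rational.Solver using (module +-*-Solver)
open import Data.Fin as Fin using (Fin; toℕ; fromℕ<)
import Data.Fin.Properties as Finₚ
open import Data.List as List using (List; []; _∷_; length; filter; upTo; allFin)
open import Data.List.Extrema.Nat using (max)
open import Data.Vec as Vec using (Vec; []; _∷_)
import Data.Vec.Properties as Vecₚ
open import Data.Product using (∃-syntax; _×_; _,_)
open import Data.Sum using (inj₁; inj₂)
open import Relation.Binary.PropositionalEquality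

-- Real numbers: Cauchy sequences of rationals, with _≃_ as equality.

record ℝ : Set where
  constructor mkℝ
  field
    seq    : ℕ → ℚ
    cauchy : ∀ ε → 0ℚ ℚ.< ε →
             ∃[ N ] (∀ m n → N ℕ.≤ m → N ℕ.≤ n → ℚ.∣ seq m ℚ.- seq n ∣ ℚ.≤ ε)

open ℝ public

infix  4 _≃_ _≤ᴿ_
infixl 6 _+ᴿ_ _-ᴿ_
infixr 7 _•_
infix  8 -ᴿ_
infix  4 _⟶_
infixr 7 _·ᵛ_

_≃_ : ℝ → ℝ → Set
x ≃ y = ∀ ε → 0ℚ ℚ.< ε →
        ∃[ N ] (∀ n → N ℕ.≤ n → ℚ.∣ seq x n ℚ.- seq y n ∣ ℚ.≤ ε)

_≤ᴿ_ : ℝ → ℝ → Set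
x ≤ᴿ y = ∀ ε → 0ℚ ℚ.< ε →
         ∃[ N ] (∀ n → N ℕ.≤ n → seq x n ℚ.≤ seq y n ℚ.+ ε)

half-pos : ∀ {ε} → 0ℚ ℚ.< ε → 0ℚ ℚ.< ½ ℚ.* ε
half-pos {ε} 0<ε =
  subst (ℚ._< ½ ℚ.* ε) (ℚₚ.*-zeroʳ ½) (ℚₚ.*-monoʳ-<-pos ½ 0<ε)

halves : ∀ ε → ½ ℚ.* ε ℚ.+ ½ ℚ.* ε ≡ ε
halves ε = trans (sym (ℚₚ.*-distribʳ-+ ε ½ ½)) (ℚₚ.*-identityˡ ε)

sub-interchange : ∀ a b c d →
  (a ℚ.+ b) ℚ.- (c ℚ.+ d) ≡ (a ℚ.- c) ℚ.+ (b ℚ.- d)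
sub-interchange = solve 4 (λ a b c d →
  (a :+ b) :- (c :+ d) := (a :- c) :+ (b :- d)) refl
  where open +-*-Solver

∣∣-sub : ∀ a b → ℚ.∣ a ∣ ℚ.- ℚ.∣ b ∣ ℚ.≤ ℚ.∣ a ℚ.- b ∣
∣∣-sub a b = begin
  ℚ.∣ a ∣ ℚ.- ℚ.∣ b ∣
    ≡⟨ cong (λ z → ℚ.∣ z ∣ ℚ.- ℚ.∣ b ∣) (split a b) ⟩
  ℚ.∣ (a ℚ.- b) ℚ.+ b ∣ ℚ.- ℚ.∣ b ∣
    ≤⟨ ℚₚ.+-monoˡ-≤ (ℚ.- ℚ.∣ b ∣) (ℚₚ.∣p+q∣≤∣p∣+∣q∣ (a ℚ.- b) b) ⟩
  ℚ.∣ a ℚ.- b ∣ ℚ.+ ℚ.∣ b ∣ ℚ.- ℚ.∣ b ∣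
    ≡⟨ cancel ℚ.∣ a ℚ.- b ∣ ℚ.∣ b ∣ ⟩
  ℚ.∣ a ℚ.- b ∣ ∎
  where
  open ℚₚ.≤-Reasoning
  open +-*-Solver
  split : ∀ x y → x ≡ (x ℚ.- y) ℚ.+ y
  split = solve 2 (λ x y → x := (x :- y) :+ y) refl
  cancel : ∀ x y → x ℚ.+ y ℚ.- y ≡ x
  cancel = solve 2 (λ x y → x :+ y :- y := x) refl

neg-sub : ∀ a b → ℚ.- (a ℚ.- b) ≡ b ℚ.- a
neg-sub = solve 2 (λ a b → :- (a :- b) := b :- a) refl
  where open +-*-Solver

∣sub∣-sym : ∀ a b → ℚ.∣ a ℚ.- b ∣ ≡ ℚ.∣ b ℚ.- a ∣
∣sub∣-sym a b = trans (cong ℚ.∣_∣ (sym (neg-sub b a))) (ℚₚ.∣-p∣≡∣p∣ (b ℚ.- a))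

∣∣-lipschitz : ∀ a b → ℚ.∣ ℚ.∣ a ∣ ℚ.- ℚ.∣ b ∣ ∣ ℚ.≤ ℚ.∣ a ℚ.- b ∣
∣∣-lipschitz a b with ℚₚ.∣p∣≡p∨∣p∣≡-p (ℚ.∣ a ∣ ℚ.- ℚ.∣ b ∣)
... | inj₁ eq = subst (ℚ._≤ ℚ.∣ a ℚ.- b ∣) (sym eq) (∣∣-sub a b)
... | inj₂ eq = subst₂ ℚ._≤_
  (sym (trans eq (neg-sub ℚ.∣ a ∣ ℚ.∣ b ∣))) (∣sub∣-sym b a) (∣∣-sub b a)

factor : ∀ r a b → r ℚ.* a ℚ.- r ℚ.* b ≡ r ℚ.* (a ℚ.- b)
factor = solve 3 (λ r a b → r :* a :- r :* b := r :* (a :- b)) refl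
  where open +-*-Solver

fromℚ : ℚ → ℝ
fromℚ r = mkℝ (λ _ → r) λ ε 0<ε → 0 , λ _ _ _ _ →
  subst (λ z → ℚ.∣ z ∣ ℚ.≤ ε) (sym (ℚₚ.+-inverseʳ r)) (ℚₚ.<⇒≤ 0<ε)

0ᴿ : ℝ
0ᴿ = fromℚ 0ℚ

_+ᴿ_ : ℝ → ℝ → ℝ
x +ᴿ y = mkℝ (λ n → seq x n ℚ.+ seq y n) λ ε 0<ε →
  let (M , p) = cauchy x (½ ℚ.* ε) (half-pos 0<ε)
      (N , q) = cauchy y (½ ℚ.* ε) (half-pos 0<ε)
  in M ℕ.⊔ N , λ m n K≤m K≤n →
  let open ℚₚ.≤-Reasoning in begin
    ℚ.∣ (seq x m ℚ.+ seq y m) ℚ.- (seq x n ℚ.+ seq y n) ∣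
      ≡⟨ cong ℚ.∣_∣ (sub-interchange (seq x m) (seq y m) (seq x n) (seq y n)) ⟩
    ℚ.∣ (seq x m ℚ.- seq x n) ℚ.+ (seq y m ℚ.- seq y n) ∣
      ≤⟨ ℚₚ.∣p+q∣≤∣p∣+∣q∣ (seq x m ℚ.- seq x n) (seq y m ℚ.- seq y n) ⟩
    ℚ.∣ seq x m ℚ.- seq x n ∣ ℚ.+ ℚ.∣ seq y m ℚ.- seq y n ∣
      ≤⟨ ℚₚ.+-mono-≤
           (p m n (ℕₚ.≤-trans (ℕₚ.m≤m⊔n M N) K≤m) (ℕₚ.≤-trans (ℕₚ.m≤m⊔n M N) K≤n))
           (q m n (ℕₚ.≤-trans (ℕₚ.m≤n⊔m M N) K≤m) (ℕₚ.≤-trans (ℕₚ.m≤n⊔m M N) K≤n)) ⟩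
    ½ ℚ.* ε ℚ.+ ½ ℚ.* ε
      ≡⟨ halves ε ⟩
    ε ∎

-- Rational scalars suffice: the matrix P has rational entries.
_•_ : ℚ → ℝ → ℝ
r • x = mkℝ (λ n → r ℚ.* seq x n) λ ε 0<ε →
  let instance
        εPos : ℚ.Positive ε
        εPos = ℚ.positive 0<ε
        iεPos : ℚ.Positive (i ℚ.* ε)
        iεPos = ℚₚ.pos*pos⇒pos i ε
        iεNonNeg : ℚ.NonNegative (i ℚ.* ε)
        iεNonNeg = ℚₚ.pos⇒nonNeg (i ℚ.* ε)
      (N , p) = cauchy x (i ℚ.* ε) (ℚₚ.positive⁻¹ (i ℚ.* ε))
  in N , λ m n N≤m N≤n →
  let open ℚₚ.≤-Reasoning in begin
    ℚ.∣ r ℚ.* seq x m ℚ.- r ℚ.* seq x n ∣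
      ≡⟨ cong ℚ.∣_∣ (factor r (seq x m) (seq x n)) ⟩
    ℚ.∣ r ℚ.* (seq x m ℚ.- seq x n) ∣
      ≡⟨ ℚₚ.∣p*q∣≡∣p∣*∣q∣ r (seq x m ℚ.- seq x n) ⟩
    ℚ.∣ r ∣ ℚ.* ℚ.∣ seq x m ℚ.- seq x n ∣
      ≤⟨ ℚₚ.*-monoˡ-≤-nonNeg ℚ.∣ r ∣ (p m n N≤m N≤n) ⟩
    ℚ.∣ r ∣ ℚ.* (i ℚ.* ε)
      ≤⟨ ℚₚ.*-monoʳ-≤-nonNeg (i ℚ.* ε) ∣r∣≤b ⟩
    b ℚ.* (i ℚ.* ε)
      ≡⟨ ℚₚ.*-assoc b i ε ⟨
    b ℚ.* i ℚ.* ε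
      ≡⟨ cong (ℚ._* ε) (ℚₚ.*-inverseʳ b) ⟩
    1ℚ ℚ.* ε
      ≡⟨ ℚₚ.*-identityˡ ε ⟩
    ε ∎
  where
  b : ℚ
  b = ℚ.∣ r ∣ ℚ.+ 1ℚ
  instance
    rNonNeg : ℚ.NonNegative ℚ.∣ r ∣
    rNonNeg = ℚₚ.∣-∣-nonNeg r
    bPos : ℚ.Positive b
    bPos = ℚₚ.nonNeg+pos⇒pos ℚ.∣ r ∣ 1ℚ
    bNonZero : ℚ.NonZero b
    bNonZero = ℚₚ.pos⇒nonZero b
  i : ℚ
  i = ℚ.1/ b
  instance
    iPos : ℚ.Positive i
    iPos = ℚₚ.1/pos⇒pos b
  ∣r∣≤b : ℚ.∣ r ∣ ℚ.≤ b
  ∣r∣≤b = subst (ℚ._≤ b) (ℚₚ.+-identityʳ ℚ.∣ r ∣)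
    (ℚₚ.+-monoʳ-≤ ℚ.∣ r ∣ (ℚₚ.nonNegative⁻¹ 1ℚ))

-ᴿ_ : ℝ → ℝ
-ᴿ x = (ℚ.- 1ℚ) • x

_-ᴿ_ : ℝ → ℝ → ℝ
x -ᴿ y = x +ᴿ (-ᴿ y)

∣_∣ᴿ : ℝ → ℝ
∣ x ∣ᴿ = mkℝ (λ n → ℚ.∣ seq x n ∣) λ ε 0<ε →
  let (N , p) = cauchy x ε 0<ε
  in N , λ m n N≤m N≤n →
     ℚₚ.≤-trans (∣∣-lipschitz (seq x m) (seq x n)) (p m n N≤m N≤n)

sumᴿ : List ℝ → ℝ
sumᴿ = List.foldr _+ᴿ_ 0ᴿ

_⟶_ : (ℕ → ℝ) → ℝ → Set
a ⟶ x = ∀ ε → 0ℚ ℚ.< ε →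
        ∃[ N ] (∀ n → N ℕ.≤ n → ∣ a n -ᴿ x ∣ᴿ ≤ᴿ fromℚ ε)

IsRational : ℝ → Set
IsRational x = ∃[ r ] x ≃ fromℚ r

-- For q ≥ 2 and n > 0 every k with q ^ k ∣ n satisfies k ≤ n, so the bound on
-- the search loses nothing.
v : ℕ → ℕ → ℕ
v q zero      = 0
v q n@(suc _) = max 0 (filter (λ k → q ℕ.^ k ℕ∣.∣? n) (upTo (suc n)))

Σ[0⋯_] : ℕ → (ℕ → ℕ) → ℕ
Σ[0⋯ zero  ] f = f 0
Σ[0⋯ suc n ] f = Σ[0⋯ n ] f ℕ.+ f (suc n)

w : ℕ → ℕ → ℕ
w q n = Σ[0⋯ n ] (v q)

u : ℕ → ℕ → ℕ
u q n = Σ[0⋯ n ] (w q)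

form : ℕ → Vec ℤ 5 → ℕ → ℤ
form q (θu ∷ θw ∷ θ₂ ∷ θ₁ ∷ θ₀ ∷ []) n =
  θu ℤ.* + u q n ℤ.+ θw ℤ.* + w q n ℤ.+ θ₂ ℤ.* + (n ℕ.* suc n ℕ./ 2)
    ℤ.+ θ₁ ℤ.* + n ℤ.+ θ₀

γ : ℕ → (q d : ℕ) → Vec ℤ 5 → ℕ
γ A q d s = length (filter (λ n → + d ℤ∣.∣? form q s n) (upTo A))

-- ℤ/dℤ is Fin d, a class being given by its least non-negative representative.

reduce : (d : ℕ) .{{_ : NonZero d}} → ℤ → Fin d
reduce d a = fromℕ< (ℤDM.n%ℕd<d a d)

rep : ∀ {d} → Fin d → ℤ
rep x = + toℕ x

module _ {d : ℕ} .{{_ : NonZero d}} where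

  infixl 6 _⊕_
  infixl 7 _⊗_ _⊛_

  _⊕_ _⊗_ : Fin d → Fin d → Fin d
  x ⊕ y = reduce d (rep x ℤ.+ rep y)
  x ⊗ y = reduce d (rep x ℤ.* rep y)

  _⊛_ : ∀ {m n} → Vec (Fin d) m → Vec (Vec (Fin d) n) m → Vec (Fin d) n
  s ⊛ A = Vec.tabulate λ j →
    Vec.foldr′ _⊕_ (reduce d (+ 0))
      (Vec.zipWith _⊗_ s (Vec.map (λ row → Vec.lookup row j) A))

State : ℕ → Set
State d = Vec (Fin d) 5

-- The sequence is indexed from N = 1.
IsDensity : (q d : ℕ) → State d → ℝ → Set
IsDensity q d s x =
  (λ k → fromℚ (+ γ (suc k) q d (Vec.map rep s) ℚ./ suc k)) ⟶ x

Mℤ : (q l : ℕ) → Vec (Vec ℤ 5) 5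
Mℤ q l =
  (+ q ∷ l-q+1 ∷ + q         ∷ l-q+1                        ∷ + 0                 ∷ []) ∷
  (+ 0 ∷ + 1   ∷ + 0         ∷ + 1                          ∷ + 0                 ∷ []) ∷
  (+ 0 ∷ + 0   ∷ + (q ℕ.^ 2) ∷ + (l ℕ.* q) ℤ.- + [q²-q]/2   ∷ + (l ℕ.* suc l ℕ./ 2) ∷ []) ∷
  (+ 0 ∷ + 0   ∷ + 0         ∷ + q                          ∷ + l                 ∷ []) ∷
  (+ 0 ∷ + 0   ∷ + 0         ∷ + 0                          ∷ + 1                 ∷ []) ∷ []
  where
  l-q+1    = + l ℤ.- + q ℤ.+ + 1
  [q²-q]/2 = q ℕ.* (q ℕ.∸ 1) ℕ./ 2

M : (q d : ℕ) .{{_ : NonZero d}} → Fin q → Vec (State d) 5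
M q d l = Vec.map (Vec.map (reduce d)) (Mℤ q (toℕ l))

μ : (q d : ℕ) .{{_ : NonZero d}} → State d → State d → ℕ
μ q d s t = length (filter (λ l → Vecₚ.≡-dec Finₚ._≟_ t (s ⊛ M q d l)) (allFin q))

P : (q d : ℕ) .{{_ : NonZero q}} .{{_ : NonZero d}} → State d → State d → ℚ
P q d s t = + μ q d s t ℚ./ q

allVecs : (d n : ℕ) → List (Vec (Fin d) n)
allVecs d zero    = [] ∷ []
allVecs d (suc n) = List.cartesianProductWith _∷_ (allFin d) (allVecs d n)

_·ᵛ_ : ∀ {d} → (State d → State d → ℚ) → (State d → ℝ) → State d → ℝ
_·ᵛ_ {d} A x s = sumᴿ (List.map (λ t → A s t • x t) (allVecs d 5))

{-# OPTIONS --safe #-}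
module Submission where

-- Writing n = qm + λ, the form of s at n is the form of s M_λ at m, so
-- γ(qN; s) = Σ_λ γ(N; s M_λ); dividing by qN and letting N → ∞ gives P δ = δ.
--
-- For rationality let a_k(s) = γ(qᵏ; s) / qᵏ, so that a_{k+1} = P a_k. The vectors a₀, …, a_n
-- with n = d⁵ are linearly dependent over ℚ, and applying powers of P shows that every sequence
-- k ↦ a_k(s) satisfies Σⱼ cⱼ a_{k+j}(s) = 0 for all k with c ≠ 0. The limit L of a rational
-- sequence with Σⱼ cⱼ a_{k+j} = β satisfies c(1) L = β, where c(X) = Σⱼ cⱼ Xʲ. If c(1) ≠ 0 this
-- determines L; if c(1) = 0 then β = 0 and c / (1 − X) also turns the sequence into a constant,
-- so one concludes by induction on the degree of c.

open import Defs
open import Data.Bool using (true; false; if_then_else_)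
open import Data.Nat as ℕ using (ℕ; zero; suc; _+_; _*_; _^_; _≤_; _<_; z≤n; s≤s; NonZero)
import Data.Nat.Properties as ℕₚ
import Data.Nat.DivMod as ℕDM
open import Data.Nat.Divisibility as ℕ∣ using () renaming (_∣_ to _∣ℕ_)
import Data.Nat.Tactic.RingSolver as ℕSolver
open import Data.Integer as ℤ using (ℤ)
import Data.Integer.Properties as ℤₚ
import Data.Integer.DivMod as ℤDM
import Data.Integer.Tactic.RingSolver as ℤSolver
open import Data.Integer.Divisibility.Signed as ℤ∣ using () renaming (_∣_ to _∣ℤ_)
open import Data.Rational as ℚ using (ℚ; 0ℚ; 1ℚ; ½)
open import Data.Rational.Unnormalised as ℚᵘ using (mkℚᵘ; *≡*)
import Data.Rational.Unnormalised.Properties as ℚᵘₚ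
import Data.Rational.Properties as ℚₚ
open import Data.Rational.Solver using (module +-*-Solver)
open import Data.Fin as Fin using (Fin; toℕ; punchIn)
import Data.Fin.Properties as Finₚ
open import Data.List as List using (List; []; _∷_; length; filter; upTo)
import Data.List.Properties as Listₚ
open import Data.List.Extrema.Nat using (argmax-sel; xs≤max)
open import Data.List.Membership.Propositional using (_∈_)
open import Data.List.Membership.Propositional.Properties
  using (∈-filter⁺; ∈-filter⁻; ∈-upTo⁺; ∈-cartesianProductWith⁺; ∈-allFin)
open import Data.List.Relation.Unary.Any as ListAny using (here; there)
import Data.List.Relation.Unary.Any.Properties as Anyₚ
open import Data.List.Relation.Unary.All as All using (All; []; _∷_)
open import Data.List.Relation.Unary.AllPairs using ([]; _∷_)
open import Data.List.Relation.Unary.Unique.Propositional using (Unique)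
open import Data.List.Relation.Unary.Unique.Propositional.Properties
  using (allFin⁺; cartesianProductWith⁺)
open import Data.Vec as Vec using (Vec; []; _∷_)
import Data.Vec.Properties as Vecₚ
open import Data.Vec.Relation.Unary.Any using (Any; here; there)
import Data.Vec.Relation.Unary.Any.Properties as VecAnyₚ
open import Data.Vec.Functional using (insertAt)
open import Data.Vec.Functional.Properties using (insertAt-lookup; insertAt-punchIn)
open import Data.Product using (∃-syntax; Σ-syntax; _×_; _,_; proj₂)
open import Data.Sum using (inj₁; inj₂)
open import Algebra.Bundles using (CommutativeRing)
import Algebra.Properties.Semiring.Sum as SemiringSum
open import Function using (_∘_; _$_; id; _⇔_; mk⇔; Equivalence)
open import Relation.Unary using (Pred; Decidable)
open import Relation.Nullary using (Dec; does; yes; no; ¬_; ¬?; contradiction; decidable-stable)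
open import Relation.Nullary.Decidable using (toWitness)
open import Relation.Binary.PropositionalEquality

open SemiringSum (CommutativeRing.semiring ℚₚ.+-*-commutativeRing)
  using (sum; sum-cong-≗; sum-remove; sum-replicate-zero; ∑-distrib-+; ∑-comm;
         *-distribˡ-sum; *-distribʳ-sum)
module ℕΣ = SemiringSum ℕₚ.+-*-semiring

-- Limits of rational sequences

-- `x ≃ y` unfolds to `Null` of the difference of the two sequences, so a proof of `Null` serves
-- directly as a proof of `_≃_`.
Null : (ℕ → ℚ) → Set
Null z = ∀ ε → 0ℚ ℚ.< ε → ∃[ N ] (∀ n → N ℕ.≤ n → ℚ.∣ z n ∣ ℚ.≤ ε)

null-cong : ∀ {y z} → (∀ n → y n ≡ z n) → Null y → Null z
null-cong eq null ε 0<ε = let (N , p) = null ε 0<ε in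
  N , λ n N≤n → subst (λ t → ℚ.∣ t ∣ ℚ.≤ ε) (eq n) (p n N≤n)

null-0 : Null (λ _ → 0ℚ)
null-0 ε 0<ε = 0 , λ _ _ → ℚₚ.<⇒≤ 0<ε

null-+ : ∀ {y z} → Null y → Null z → Null (λ n → y n ℚ.+ z n)
null-+ {y} {z} p r ε 0<ε =
  let (M , p′) = p (½ ℚ.* ε) (half-pos 0<ε)
      (N , r′) = r (½ ℚ.* ε) (half-pos 0<ε)
  in M ℕ.⊔ N , λ n K≤n → begin
    ℚ.∣ y n ℚ.+ z n ∣         ≤⟨ ℚₚ.∣p+q∣≤∣p∣+∣q∣ (y n) (z n) ⟩
    ℚ.∣ y n ∣ ℚ.+ ℚ.∣ z n ∣   ≤⟨ ℚₚ.+-mono-≤ (p′ n (ℕₚ.m⊔n≤o⇒m≤o M N K≤n)) (r′ n (ℕₚ.m⊔n≤o⇒n≤o M N K≤n)) ⟩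
    ½ ℚ.* ε ℚ.+ ½ ℚ.* ε       ≡⟨ halves ε ⟩
    ε                         ∎
  where open ℚₚ.≤-Reasoning

null-* : ∀ r {z} → Null z → Null (λ n → r ℚ.* z n)
null-* r {z} null ε 0<ε =
  let instance
        εPos : ℚ.Positive ε
        εPos = ℚ.positive 0<ε
        iεPos : ℚ.Positive (i ℚ.* ε)
        iεPos = ℚₚ.pos*pos⇒pos i ε
        iεNonNeg : ℚ.NonNegative (i ℚ.* ε)
        iεNonNeg = ℚₚ.pos⇒nonNeg (i ℚ.* ε)
      (N , p) = null (i ℚ.* ε) (ℚₚ.positive⁻¹ (i ℚ.* ε))
  in N , λ n N≤n → begin
    ℚ.∣ r ℚ.* z n ∣         ≡⟨ ℚₚ.∣p*q∣≡∣p∣*∣q∣ r (z n) ⟩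
    ℚ.∣ r ∣ ℚ.* ℚ.∣ z n ∣   ≤⟨ ℚₚ.*-monoˡ-≤-nonNeg ℚ.∣ r ∣ (p n N≤n) ⟩
    ℚ.∣ r ∣ ℚ.* (i ℚ.* ε)   ≤⟨ ℚₚ.*-monoʳ-≤-nonNeg (i ℚ.* ε) ∣r∣≤b ⟩
    b ℚ.* (i ℚ.* ε)         ≡⟨ ℚₚ.*-assoc b i ε ⟨
    b ℚ.* i ℚ.* ε           ≡⟨ cong (ℚ._* ε) (ℚₚ.*-inverseʳ b) ⟩
    1ℚ ℚ.* ε                ≡⟨ ℚₚ.*-identityˡ ε ⟩
    ε                       ∎
  where
  open ℚₚ.≤-Reasoning
  b : ℚ
  b = ℚ.∣ r ∣ ℚ.+ 1ℚ
  instance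
    rNonNeg : ℚ.NonNegative ℚ.∣ r ∣
    rNonNeg = ℚₚ.∣-∣-nonNeg r
    bPos : ℚ.Positive b
    bPos = ℚₚ.nonNeg+pos⇒pos ℚ.∣ r ∣ 1ℚ
    bNonZero : ℚ.NonZero b
    bNonZero = ℚₚ.pos⇒nonZero b
  i : ℚ
  i = ℚ.1/ b
  instance
    iPos : ℚ.Positive i
    iPos = ℚₚ.1/pos⇒pos b
  ∣r∣≤b : ℚ.∣ r ∣ ℚ.≤ b
  ∣r∣≤b = subst (ℚ._≤ b) (ℚₚ.+-identityʳ ℚ.∣ r ∣)
    (ℚₚ.+-monoʳ-≤ ℚ.∣ r ∣ (ℚₚ.nonNegative⁻¹ 1ℚ))

null-sum : ∀ {m} (z : Fin m → ℕ → ℚ) → (∀ i → Null (z i)) → Null (λ n → sum (λ i → z i n))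
null-sum {zero}  z null = null-0
null-sum {suc m} z null = null-+ (null Fin.zero) (null-sum (z ∘ Fin.suc) (null ∘ Fin.suc))

null-const : ∀ {r} → Null (λ _ → r) → r ≡ 0ℚ
null-const {r} null with r ℚ.≟ 0ℚ
... | yes eq = eq
-- The tolerance is half of `∣ r ∣`, which a nonzero constant exceeds at every index.
... | no r≢0 = contradiction (proj₂ (null (½ ℚ.* ℚ.∣ r ∣) (half-pos 0<∣r∣)) _ ℕₚ.≤-refl)
  (λ ∣r∣≤½∣r∣ → ℚₚ.<-irrefl refl (ℚₚ.<-≤-trans ½∣r∣<∣r∣ ∣r∣≤½∣r∣))
  where
  0<∣r∣ : 0ℚ ℚ.< ℚ.∣ r ∣
  0<∣r∣ = ℚₚ.≰⇒> λ ∣r∣≤0 → r≢0 (ℚₚ.∣p∣≡0⇒p≡0 r (ℚₚ.≤-antisym ∣r∣≤0 (ℚₚ.0≤∣p∣ r)))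
  instance
    ∣r∣Pos : ℚ.Positive ℚ.∣ r ∣
    ∣r∣Pos = ℚ.positive 0<∣r∣
  ½∣r∣<∣r∣ : ½ ℚ.* ℚ.∣ r ∣ ℚ.< ℚ.∣ r ∣
  ½∣r∣<∣r∣ = subst (½ ℚ.* ℚ.∣ r ∣ ℚ.<_) (ℚₚ.*-identityˡ ℚ.∣ r ∣)
    (ℚₚ.*-monoˡ-<-pos ℚ.∣ r ∣ (toWitness {a? = ½ ℚₚ.<? 1ℚ} _))

infix 4 _⇝_
-- The diagonal form of convergence: comparing `a n` with the n-th approximation of `x` turns a
-- limit in the reals into a single null sequence of rationals.
_⇝_ : (ℕ → ℚ) → ℝ → Set
a ⇝ x = Null (λ n → a n ℚ.- seq x n)

⟶⇒⇝ : ∀ {a x} → (λ n → fromℚ (a n)) ⟶ x → a ⇝ x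
⟶⇒⇝ {a} {x} lim ε 0<ε =
  -- A quarter of `ε` is the tolerance of the limit, a quarter is the slack in `_≤ᴿ_`, and the
  -- remaining half pays for moving from approximation `n` of `x` to approximation `k`.
  let h = ½ ℚ.* ε
      0<h = half-pos 0<ε
      (M , p) = lim (½ ℚ.* h) (half-pos 0<h)
      (N , r) = cauchy x h 0<h
  in M ℕ.⊔ N , λ k K≤k →
  let (M′ , p′) = p k (ℕₚ.m⊔n≤o⇒m≤o M N K≤k) (½ ℚ.* h) (half-pos 0<h)
      n = M′ ℕ.⊔ N
  in begin
    ℚ.∣ a k ℚ.- seq x k ∣
      ≡⟨ cong ℚ.∣_∣ (split (a k) (seq x k) (seq x n)) ⟩
    ℚ.∣ (a k ℚ.+ ℚ.- 1ℚ ℚ.* seq x n) ℚ.+ (seq x n ℚ.- seq x k) ∣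
      ≤⟨ ℚₚ.∣p+q∣≤∣p∣+∣q∣ (a k ℚ.+ ℚ.- 1ℚ ℚ.* seq x n) (seq x n ℚ.- seq x k) ⟩
    ℚ.∣ a k ℚ.+ ℚ.- 1ℚ ℚ.* seq x n ∣ ℚ.+ ℚ.∣ seq x n ℚ.- seq x k ∣
      ≤⟨ ℚₚ.+-mono-≤ (p′ n (ℕₚ.m≤m⊔n M′ N)) (r n k (ℕₚ.m≤n⊔m M′ N) (ℕₚ.m⊔n≤o⇒n≤o M N K≤k)) ⟩
    ½ ℚ.* h ℚ.+ ½ ℚ.* h ℚ.+ h
      ≡⟨ cong (ℚ._+ h) (halves h) ⟩
    h ℚ.+ h
      ≡⟨ halves ε ⟩
    ε ∎
  where
  open ℚₚ.≤-Reasoning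
  open +-*-Solver
  split : ∀ a y z → a ℚ.- y ≡ (a ℚ.+ ℚ.- 1ℚ ℚ.* z) ℚ.+ (z ℚ.- y)
  split = solve 3 (λ a y z → a :- y := (a :+ :- con 1ℚ :* z) :+ (z :- y)) refl

-- `a ∘ φ` stays close to `seq x ∘ φ`, which stays close to `seq x` by the Cauchy property.
⇝-reindex : ∀ {a x} (φ : ℕ → ℕ) → (∀ n → n ℕ.≤ φ n) → a ⇝ x → a ∘ φ ⇝ x
⇝-reindex {a} {x} φ n≤φ lim = null-cong (λ n → telescope (a (φ n)) (seq x (φ n)) (seq x n))
  (null-+ {λ n → a (φ n) ℚ.- seq x (φ n)} {λ n → seq x (φ n) ℚ.- seq x n}
    (λ ε 0<ε → let (N , p) = lim ε 0<ε in N , λ n N≤n → p (φ n) (ℕₚ.≤-trans N≤n (n≤φ n)))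
    (λ ε 0<ε → let (N , p) = cauchy x ε 0<ε in
      N , λ n N≤n → p (φ n) n (ℕₚ.≤-trans N≤n (n≤φ n)) N≤n))
  where
  open +-*-Solver
  telescope : ∀ a y z → (a ℚ.- y) ℚ.+ (y ℚ.- z) ≡ a ℚ.- z
  telescope = solve 3 (λ a y z → (a :- y) :+ (y :- z) := a :- z) refl

-- Since `a` is the average of the `f l`, the difference splits into `r` times the sum of the errors
-- x_l - f_l, plus a - y, and both are null.
limit-of-average : ∀ {m} r (f : Fin m → ℕ → ℚ) (x : Fin m → ℝ) → (∀ l → f l ⇝ x l) →
  ∀ {a y} → (∀ n → a n ≡ r ℚ.* sum (λ l → f l n)) → a ⇝ y →
  Null (λ n → r ℚ.* sum (λ l → seq (x l) n) ℚ.- seq y n)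
limit-of-average r f x lim {a} {y} average lim-a =
  null-cong eq (null-+ {λ n → r ℚ.* sum (λ l → error l n)} {λ n → a n ℚ.- seq y n}
    (null-* r (null-sum error (λ l → null-* (ℚ.- 1ℚ) (lim l)))) lim-a)
  where
  open ≡-Reasoning
  open +-*-Solver
  error : ∀ l n → ℚ
  error l n = ℚ.- 1ℚ ℚ.* (f l n ℚ.- seq (x l) n)
  regroup : ∀ r a b y → r ℚ.* a ℚ.+ (r ℚ.* b ℚ.- y) ≡ r ℚ.* (a ℚ.+ b) ℚ.- y
  regroup = solve 4 (λ r a b y → r :* a :+ (r :* b :- y) := r :* (a :+ b) :- y) refl
  cancel : ∀ f x → ℚ.- 1ℚ ℚ.* (f ℚ.- x) ℚ.+ f ≡ x
  cancel = solve 2 (λ f x → :- con 1ℚ :* (f :- x) :+ f := x) refl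
  eq : ∀ n → r ℚ.* sum (λ l → error l n) ℚ.+ (a n ℚ.- seq y n) ≡ r ℚ.* sum (λ l → seq (x l) n) ℚ.- seq y n
  eq n = begin
    r ℚ.* sum (λ l → error l n) ℚ.+ (a n ℚ.- seq y n)
      ≡⟨ cong (λ z → r ℚ.* sum (λ l → error l n) ℚ.+ (z ℚ.- seq y n)) (average n) ⟩
    r ℚ.* sum (λ l → error l n) ℚ.+ (r ℚ.* sum (λ l → f l n) ℚ.- seq y n)
      ≡⟨ regroup r (sum (λ l → error l n)) (sum (λ l → f l n)) (seq y n) ⟩
    r ℚ.* (sum (λ l → error l n) ℚ.+ sum (λ l → f l n)) ℚ.- seq y n
      ≡⟨ cong (λ z → r ℚ.* z ℚ.- seq y n) (trans (sym (∑-distrib-+ (λ l → error l n) (λ l → f l n)))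
           (sum-cong-≗ (λ l → cancel (f l n) (seq (x l) n)))) ⟩
    r ℚ.* sum (λ l → seq (x l) n) ℚ.- seq y n ∎

open ≡-Reasoning

-- Linear recurrences

-- For the polynomial c(X) with coefficients `cs`, this is c of the shift operator applied to `a`,
-- read at index 0. In the same notation `total cs` is c(1).
apply : ∀ {n} → Vec ℚ n → (ℕ → ℚ) → ℚ
apply []       a = 0ℚ
apply (c ∷ cs) a = c ℚ.* a 0 ℚ.+ apply cs (a ∘ suc)

total : ∀ {n} → Vec ℚ n → ℚ
total []       = 0ℚ
total (c ∷ cs) = c ℚ.+ total cs

apply-cong : ∀ {n} (cs : Vec ℚ n) {a b} → (∀ j → a j ≡ b j) → apply cs a ≡ apply cs b
apply-cong []       eq = refl
apply-cong (c ∷ cs) eq = cong₂ (λ x y → c ℚ.* x ℚ.+ y) (eq 0) (apply-cong cs (eq ∘ suc))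

apply-tabulate : ∀ {n} (c : Fin n → ℚ) a → apply (Vec.tabulate c) a ≡ sum (λ i → c i ℚ.* a (toℕ i))
apply-tabulate {zero}  c a = refl
apply-tabulate {suc n} c a = cong (c Fin.zero ℚ.* a 0 ℚ.+_) (apply-tabulate (c ∘ Fin.suc) (a ∘ suc))

apply-0 : ∀ {n} (cs : Vec ℚ n) → apply cs (λ _ → 0ℚ) ≡ 0ℚ
apply-0 []       = refl
apply-0 (c ∷ cs) = trans (cong₂ ℚ._+_ (ℚₚ.*-zeroʳ c) (apply-0 cs)) (ℚₚ.+-identityʳ 0ℚ)

apply-* : ∀ {n} (cs : Vec ℚ n) r a → apply cs (λ j → r ℚ.* a j) ≡ r ℚ.* apply cs a
apply-* []       r a = sym (ℚₚ.*-zeroʳ r)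
apply-* (c ∷ cs) r a = trans (cong (c ℚ.* (r ℚ.* a 0) ℚ.+_) (apply-* cs r (a ∘ suc)))
  (lem c r (a 0) (apply cs (a ∘ suc)))
  where
  open +-*-Solver
  lem : ∀ c r x y → c ℚ.* (r ℚ.* x) ℚ.+ r ℚ.* y ≡ r ℚ.* (c ℚ.* x ℚ.+ y)
  lem = solve 4 (λ c r x y → c :* (r :* x) :+ r :* y := r :* (c :* x :+ y)) refl

apply-+ : ∀ {n} (cs : Vec ℚ n) a b → apply cs (λ j → a j ℚ.+ b j) ≡ apply cs a ℚ.+ apply cs b
apply-+ []       a b = refl
apply-+ (c ∷ cs) a b = trans (cong (c ℚ.* (a 0 ℚ.+ b 0) ℚ.+_) (apply-+ cs (a ∘ suc) (b ∘ suc)))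
  (lem c (a 0) (b 0) (apply cs (a ∘ suc)) (apply cs (b ∘ suc)))
  where
  open +-*-Solver
  lem : ∀ c x y z w → c ℚ.* (x ℚ.+ y) ℚ.+ (z ℚ.+ w) ≡ (c ℚ.* x ℚ.+ z) ℚ.+ (c ℚ.* y ℚ.+ w)
  lem = solve 5 (λ c x y z w → c :* (x :+ y) :+ (z :+ w) := (c :* x :+ z) :+ (c :* y :+ w)) refl

apply-sum : ∀ {n m} (cs : Vec ℚ n) (g : Fin m → ℕ → ℚ) →
  apply cs (λ j → sum (λ i → g i j)) ≡ sum (λ i → apply cs (g i))
apply-sum {m = zero}  cs g = apply-0 cs
apply-sum {m = suc m} cs g = trans (apply-+ cs (g Fin.zero) (λ j → sum (λ i → g (Fin.suc i) j)))
  (cong (apply cs (g Fin.zero) ℚ.+_) (apply-sum cs (g ∘ Fin.suc)))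

-- Every shift of `a` has the same limit, so applying c multiplies the limit by c(1).
apply-⇝ : ∀ {n} (cs : Vec ℚ n) {a x} → a ⇝ x →
  Null (λ k → apply cs (λ j → a (j ℕ.+ k)) ℚ.- total cs ℚ.* seq x k)
apply-⇝ []       {x = x} lim = null-cong (λ k → lem (seq x k)) null-0
  where
  open +-*-Solver
  lem : ∀ y → 0ℚ ≡ 0ℚ ℚ.- 0ℚ ℚ.* y
  lem = solve 1 (λ y → con 0ℚ := con 0ℚ :- con 0ℚ :* y) refl
apply-⇝ (c ∷ cs) {a} {x} lim = null-cong
  (λ k → lem c (total cs) (a k) (apply cs (λ j → a (suc j ℕ.+ k))) (seq x k))
  (null-+ {λ k → c ℚ.* (a k ℚ.- seq x k)} (null-* c lim) (apply-⇝ cs {a ∘ suc} {x} (⇝-reindex {a} {x} suc ℕₚ.n≤1+n lim)))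
  where
  open +-*-Solver
  lem : ∀ c t a b y → c ℚ.* (a ℚ.- y) ℚ.+ (b ℚ.- t ℚ.* y) ≡ c ℚ.* a ℚ.+ b ℚ.- (c ℚ.+ t) ℚ.* y
  lem = solve 5 (λ c t a b y → c :* (a :- y) :+ (b :- t :* y) := c :* a :+ b :- (c :+ t) :* y) refl

-- The quotient of the polynomial c + c₁ X + … by 1 − X, when 1 is a root.
quot : ∀ {n} → ℚ → Vec ℚ n → Vec ℚ n
quot c []        = []
quot c (c′ ∷ cs) = c ∷ quot (c ℚ.+ c′) cs

-- Abel summation. The entries of `quot` are the partial sums of the coefficients; with Q for the
-- quotient, this is c(X) = (1 - X) Q(X) + c(1) X^n in the shift operator.
apply-quot : ∀ {n} c (cs : Vec ℚ n) a → apply (c ∷ cs) a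
  ≡ apply (quot c cs) a ℚ.- apply (quot c cs) (a ∘ suc) ℚ.+ total (c ∷ cs) ℚ.* a n
apply-quot c [] a = lem c (a 0)
  where
  open +-*-Solver
  lem : ∀ c x → c ℚ.* x ℚ.+ 0ℚ ≡ 0ℚ ℚ.- 0ℚ ℚ.+ (c ℚ.+ 0ℚ) ℚ.* x
  lem = solve 2 (λ c x → c :* x :+ con 0ℚ := con 0ℚ :- con 0ℚ :+ (c :+ con 0ℚ) :* x) refl
apply-quot {suc n} c (c′ ∷ cs) a = begin
  c ℚ.* a 0 ℚ.+ (c′ ℚ.* a 1 ℚ.+ y)
    ≡⟨ lem₁ c c′ (a 0) (a 1) y ⟩
  c ℚ.* a 0 ℚ.- c ℚ.* a 1 ℚ.+ apply ((c ℚ.+ c′) ∷ cs) (a ∘ suc)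
    ≡⟨ cong (c ℚ.* a 0 ℚ.- c ℚ.* a 1 ℚ.+_) (apply-quot (c ℚ.+ c′) cs (a ∘ suc)) ⟩
  c ℚ.* a 0 ℚ.- c ℚ.* a 1 ℚ.+ (s ℚ.- t ℚ.+ (c ℚ.+ c′ ℚ.+ total cs) ℚ.* a (suc n))
    ≡⟨ lem₂ c c′ (a 0) (a 1) s t (total cs) (a (suc n)) ⟩
  c ℚ.* a 0 ℚ.+ s ℚ.- (c ℚ.* a 1 ℚ.+ t) ℚ.+ (c ℚ.+ (c′ ℚ.+ total cs)) ℚ.* a (suc n) ∎
  where
  open +-*-Solver
  y = apply cs (a ∘ suc ∘ suc)
  s = apply (quot (c ℚ.+ c′) cs) (a ∘ suc)
  t = apply (quot (c ℚ.+ c′) cs) (a ∘ suc ∘ suc)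
  lem₁ : ∀ c c′ x z y → c ℚ.* x ℚ.+ (c′ ℚ.* z ℚ.+ y) ≡ c ℚ.* x ℚ.- c ℚ.* z ℚ.+ ((c ℚ.+ c′) ℚ.* z ℚ.+ y)
  lem₁ = solve 5 (λ c c′ x z y → c :* x :+ (c′ :* z :+ y) := c :* x :- c :* z :+ ((c :+ c′) :* z :+ y)) refl
  lem₂ : ∀ c c′ x z s t r w → c ℚ.* x ℚ.- c ℚ.* z ℚ.+ (s ℚ.- t ℚ.+ (c ℚ.+ c′ ℚ.+ r) ℚ.* w)
    ≡ c ℚ.* x ℚ.+ s ℚ.- (c ℚ.* z ℚ.+ t) ℚ.+ (c ℚ.+ (c′ ℚ.+ r)) ℚ.* w
  lem₂ = solve 8 (λ c c′ x z s t r w → c :* x :- c :* z :+ (s :- t :+ (c :+ c′ :+ r) :* w)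
    := c :* x :+ s :- (c :* z :+ t) :+ (c :+ (c′ :+ r)) :* w) refl

-- The first nonzero coefficient is also the first nonzero partial sum. It is not the last
-- coefficient, because the total would then be nonzero, so its partial sum is an entry of `quot`.
quot-nonzero : ∀ {n} c (cs : Vec ℚ n) → total (c ∷ cs) ≡ 0ℚ → Any (_≢ 0ℚ) (c ∷ cs) → Any (_≢ 0ℚ) (quot c cs)
quot-nonzero c []        eq (here c≢0) = contradiction (trans (sym (ℚₚ.+-identityʳ c)) eq) c≢0
quot-nonzero c (c′ ∷ cs) eq nz with c ℚ.≟ 0ℚ
... | no c≢0 = here c≢0
... | yes c≡0 = there (quot-nonzero (c ℚ.+ c′) cs (trans (ℚₚ.+-assoc c c′ (total cs)) eq) (shift nz))
  where
  c+c′≡c′ : c ℚ.+ c′ ≡ c′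
  c+c′≡c′ = trans (cong (ℚ._+ c′) c≡0) (ℚₚ.+-identityˡ c′)
  shift : Any (_≢ 0ℚ) (c ∷ c′ ∷ cs) → Any (_≢ 0ℚ) ((c ℚ.+ c′) ∷ cs)
  shift (here c≢0)           = contradiction c≡0 c≢0
  shift (there (here c′≢0))  = here (c′≢0 ∘ trans (sym c+c′≡c′))
  shift (there (there rest)) = there rest

-- An arbitrary constant `β` on the right makes the induction on the length possible: dividing by 1
-- - X turns a recurrence with value 0 into one with some constant value.
recurrent-limit-rational : ∀ {n} (cs : Vec ℚ n) → Any (_≢ 0ℚ) cs → ∀ {a x} → a ⇝ x →
  ∀ β → (∀ k → apply cs (λ j → a (j ℕ.+ k)) ≡ β) → IsRational x
recurrent-limit-rational (c ∷ cs) nz {a} {x} lim β rec with total (c ∷ cs) ℚ.≟ 0ℚ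
... | no t≢0 = t⁻¹ ℚ.* β , null-cong eq (null-* (ℚ.- t⁻¹) (apply-⇝ (c ∷ cs) {a} {x} lim))
  where
  t = total (c ∷ cs)
  instance
    t≠0 : ℚ.NonZero t
    t≠0 = ℚ.≢-nonZero t≢0
  t⁻¹ = ℚ.1/ t
  eq : ∀ k → ℚ.- t⁻¹ ℚ.* (apply (c ∷ cs) (λ j → a (j ℕ.+ k)) ℚ.- t ℚ.* seq x k) ≡ seq x k ℚ.- t⁻¹ ℚ.* β
  eq k = begin
    ℚ.- t⁻¹ ℚ.* (apply (c ∷ cs) (λ j → a (j ℕ.+ k)) ℚ.- t ℚ.* seq x k)
      ≡⟨ cong (λ b → ℚ.- t⁻¹ ℚ.* (b ℚ.- t ℚ.* seq x k)) (rec k) ⟩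
    ℚ.- t⁻¹ ℚ.* (β ℚ.- t ℚ.* seq x k)
      ≡⟨ lem t⁻¹ t β (seq x k) ⟩
    (t⁻¹ ℚ.* t) ℚ.* seq x k ℚ.- t⁻¹ ℚ.* β
      ≡⟨ cong (λ b → b ℚ.* seq x k ℚ.- t⁻¹ ℚ.* β) (ℚₚ.*-inverseˡ t) ⟩
    1ℚ ℚ.* seq x k ℚ.- t⁻¹ ℚ.* β
      ≡⟨ cong (ℚ._- t⁻¹ ℚ.* β) (ℚₚ.*-identityˡ (seq x k)) ⟩
    seq x k ℚ.- t⁻¹ ℚ.* β ∎
    where
    open +-*-Solver
    lem : ∀ i t b y → ℚ.- i ℚ.* (b ℚ.- t ℚ.* y) ≡ (i ℚ.* t) ℚ.* y ℚ.- i ℚ.* b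
    lem = solve 4 (λ i t b y → :- i :* (b :- t :* y) := (i :* t) :* y :- i :* b) refl
... | yes t≡0 = recurrent-limit-rational (quot c cs) (quot-nonzero c cs t≡0 nz) {a} {x} lim (b 0) constant
  where
  b : ℕ → ℚ
  b k = apply (quot c cs) (λ j → a (j ℕ.+ k))
  -- As c(1) = 0, `apply-⇝` says that the constant sequence `β` is null.
  β≡0 : β ≡ 0ℚ
  β≡0 = null-const (null-cong eq (apply-⇝ (c ∷ cs) {a} {x} lim))
    where
    open +-*-Solver
    lem : ∀ b y → b ℚ.- 0ℚ ℚ.* y ≡ b
    lem = solve 2 (λ b y → b :- con 0ℚ :* y := b) refl
    eq : ∀ k → apply (c ∷ cs) (λ j → a (j ℕ.+ k)) ℚ.- total (c ∷ cs) ℚ.* seq x k ≡ β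
    eq k = trans (cong₂ (λ b t → b ℚ.- t ℚ.* seq x k) (rec k) t≡0) (lem β (seq x k))
  -- As c(1) = 0, `apply-quot` reads the recurrence as b(k) - b(k + 1) = β = 0.
  step : ∀ k → b (suc k) ≡ b k
  step k = begin
    b (suc k)                                        ≡⟨ apply-cong (quot c cs) (λ j → cong a (ℕₚ.+-suc j k)) ⟩
    b′                                               ≡⟨ lem (b k) b′ (a (_ ℕ.+ k)) ⟩
    b k ℚ.- (b k ℚ.- b′ ℚ.+ 0ℚ ℚ.* a (_ ℕ.+ k))      ≡⟨ cong (λ t → b k ℚ.- (b k ℚ.- b′ ℚ.+ t ℚ.* a (_ ℕ.+ k))) t≡0 ⟨
    b k ℚ.- (b k ℚ.- b′ ℚ.+ total (c ∷ cs) ℚ.* a (_ ℕ.+ k))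
      ≡⟨ cong (λ z → b k ℚ.- z) (apply-quot c cs (λ j → a (j ℕ.+ k))) ⟨
    b k ℚ.- apply (c ∷ cs) (λ j → a (j ℕ.+ k))       ≡⟨ cong (λ z → b k ℚ.- z) (trans (rec k) β≡0) ⟩
    b k ℚ.- 0ℚ                                       ≡⟨ ℚₚ.+-identityʳ (b k) ⟩
    b k                                              ∎
    where
    b′ = apply (quot c cs) (λ j → a (suc j ℕ.+ k))
    open +-*-Solver
    lem : ∀ b b′ y → b′ ≡ b ℚ.- (b ℚ.- b′ ℚ.+ 0ℚ ℚ.* y)
    lem = solve 3 (λ b b′ y → b′ := b :- (b :- b′ :+ con 0ℚ :* y)) refl
  constant : ∀ k → b k ≡ b 0
  constant zero    = refl
  constant (suc k) = trans (step k) (constant k)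

-- Linear dependence over the rationals

LinearlyDependent : ∀ {m n} → (Fin m → Fin n → ℚ) → Set
LinearlyDependent {m} v = Σ[ c ∈ (Fin m → ℚ) ] (∃[ i ] c i ≢ 0ℚ) × (∀ j → sum (λ i → c i ℚ.* v i j) ≡ 0ℚ)

-- One step of Gaussian elimination with pivot row `p`.
clear : ∀ {m n} → (Fin (suc m) → Fin n → ℚ) → Fin (suc m) → (Fin m → ℚ) → Fin m → Fin n → ℚ
clear v p r i j = v (punchIn p i) j ℚ.- r i ℚ.* v p j

-- A relation among the cleared rows lifts to the rows of `v` once row `p` receives the coefficient
-- -S that accounts for all subtracted multiples. By `zeroth` the cleared rows vanish in column 0,
-- so a relation in the other columns is enough.
eliminate : ∀ {m n} (v : Fin (suc m) → Fin (suc n) → ℚ) p (r : Fin m → ℚ) →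
  (∀ i → v (punchIn p i) Fin.zero ≡ r i ℚ.* v p Fin.zero) →
  LinearlyDependent (λ i j → clear v p r i (Fin.suc j)) →
  LinearlyDependent v
eliminate {m} {n} v p r zeroth (c , (i , cᵢ≢0) , rel) =
  c⁺ , (punchIn p i , cᵢ≢0 ∘ trans (sym (insertAt-punchIn c p _ i))) , λ j → trans (reduction j) (reduced j)
  where
  S = sum (λ i → c i ℚ.* r i)
  c⁺ : Fin (suc m) → ℚ
  c⁺ = insertAt c p (ℚ.- S)
  open +-*-Solver
  collect : ∀ c r x y → ℚ.- (c ℚ.* r) ℚ.* y ℚ.+ c ℚ.* x ≡ c ℚ.* (x ℚ.- r ℚ.* y)
  collect = solve 4 (λ c r x y → :- (c :* r) :* y :+ c :* x := c :* (x :- r :* y)) refl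
  neg : ∀ s y → ℚ.- s ℚ.* y ≡ s ℚ.* (ℚ.- y)
  neg = solve 2 (λ s y → :- s :* y := s :* (:- y)) refl
  reduction : ∀ j → sum (λ i → c⁺ i ℚ.* v i j) ≡ sum (λ i → c i ℚ.* clear v p r i j)
  reduction j = begin
    sum (λ i → c⁺ i ℚ.* v i j)
      ≡⟨ sum-remove {i = p} (λ i → c⁺ i ℚ.* v i j) ⟩
    c⁺ p ℚ.* v p j ℚ.+ sum (λ i → c⁺ (punchIn p i) ℚ.* v (punchIn p i) j)
      ≡⟨ cong₂ ℚ._+_ (cong (ℚ._* v p j) (insertAt-lookup c p (ℚ.- S)))
           (sum-cong-≗ (λ i → cong (ℚ._* v (punchIn p i) j) (insertAt-punchIn c p (ℚ.- S) i))) ⟩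
    ℚ.- S ℚ.* v p j ℚ.+ sum (λ i → c i ℚ.* v (punchIn p i) j)
      ≡⟨ cong (ℚ._+ sum (λ i → c i ℚ.* v (punchIn p i) j))
           (trans (neg S (v p j)) (trans (*-distribʳ-sum (ℚ.- v p j) (λ i → c i ℚ.* r i))
             (sum-cong-≗ (λ i → sym (neg (c i ℚ.* r i) (v p j)))))) ⟩
    sum (λ i → ℚ.- (c i ℚ.* r i) ℚ.* v p j) ℚ.+ sum (λ i → c i ℚ.* v (punchIn p i) j)
      ≡⟨ ∑-distrib-+ (λ i → ℚ.- (c i ℚ.* r i) ℚ.* v p j) (λ i → c i ℚ.* v (punchIn p i) j) ⟨
    sum (λ i → ℚ.- (c i ℚ.* r i) ℚ.* v p j ℚ.+ c i ℚ.* v (punchIn p i) j)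
      ≡⟨ sum-cong-≗ (λ i → collect (c i) (r i) (v (punchIn p i) j) (v p j)) ⟩
    sum (λ i → c i ℚ.* clear v p r i j) ∎
  reduced : ∀ j → sum (λ i → c i ℚ.* clear v p r i j) ≡ 0ℚ
  reduced (Fin.suc j) = rel j
  reduced Fin.zero    = begin
    sum (λ i → c i ℚ.* clear v p r i Fin.zero)
      ≡⟨ sum-cong-≗ (λ i → trans (cong (c i ℚ.*_) (trans (cong (ℚ._- r i ℚ.* v p Fin.zero) (zeroth i))
           (ℚₚ.+-inverseʳ (r i ℚ.* v p Fin.zero)))) (ℚₚ.*-zeroʳ (c i))) ⟩
    sum {m} (λ _ → 0ℚ)
      ≡⟨ sum-replicate-zero m ⟩
    0ℚ ∎

linearly-dependent : ∀ n (v : Fin (suc n) → Fin n → ℚ) → LinearlyDependent v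
-- In dimension 0 there are no coordinates to check, so the coefficient 1 will do.
linearly-dependent zero    v = (λ _ → 1ℚ) , (Fin.zero , λ ()) , λ ()
linearly-dependent (suc n) v with Finₚ.any? (λ i → ¬? (v i Fin.zero ℚ.≟ 0ℚ))
... | yes (p , pivot≢0) = eliminate v p r
  (λ i → begin
    v (punchIn p i) Fin.zero                          ≡⟨ ℚₚ.*-identityʳ _ ⟨
    v (punchIn p i) Fin.zero ℚ.* 1ℚ                   ≡⟨ cong (v (punchIn p i) Fin.zero ℚ.*_) (ℚₚ.*-inverseˡ pivot) ⟨
    v (punchIn p i) Fin.zero ℚ.* (ℚ.1/ pivot ℚ.* pivot) ≡⟨ ℚₚ.*-assoc (v (punchIn p i) Fin.zero) (ℚ.1/ pivot) pivot ⟨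
    v (punchIn p i) Fin.zero ℚ.* ℚ.1/ pivot ℚ.* pivot ∎)
  (linearly-dependent n (λ i j → clear v p r i (Fin.suc j)))
  where
  pivot = v p Fin.zero
  instance
    pivot≠0 : ℚ.NonZero pivot
    pivot≠0 = ℚ.≢-nonZero pivot≢0
  r = λ i → v (punchIn p i) Fin.zero ℚ.* ℚ.1/ pivot
-- Without a pivot column 0 is already zero, so row 0 is set aside with all multipliers 0.
... | no column≡0 = eliminate v Fin.zero (λ _ → 0ℚ)
  (λ i → trans (decidable-stable (v (Fin.suc i) Fin.zero ℚ.≟ 0ℚ) (λ ≢0 → column≡0 (Fin.suc i , ≢0)))
    (sym (ℚₚ.*-zeroˡ (v Fin.zero Fin.zero))))
  (linearly-dependent n (λ i j → clear v Fin.zero (λ _ → 0ℚ) i (Fin.suc j)))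

-- Recurrences on a finite set of states

-- Listing the states as `xs` makes each `a j` a vector of length `length xs`, and one more vector
-- than this dimension is taken.
functions-dependent : ∀ {ℓ} {A : Set ℓ} (xs : List A) → (∀ t → t ∈ xs) → (a : ℕ → A → ℚ) →
  Σ[ cs ∈ Vec ℚ (suc (length xs)) ] Any (_≢ 0ℚ) cs × (∀ t → apply cs (λ j → a j t) ≡ 0ℚ)
functions-dependent xs complete a
  with linearly-dependent (length xs) (λ i j → a (toℕ i) (List.lookup xs j))
... | c , (i , cᵢ≢0) , rel = Vec.tabulate c , VecAnyₚ.tabulate⁺ {f = c} i cᵢ≢0 , λ t →
  trans (apply-tabulate c (λ j → a j t))
    (subst (λ t → sum (λ i → c i ℚ.* a (toℕ i) t) ≡ 0ℚ) (sym (Anyₚ.lookup-index (complete t)))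
      (rel (ListAny.index (complete t))))

module _ {ℓ} {A : Set ℓ} {m} (τ : A → Fin m → A) (r : ℚ) (a : ℕ → A → ℚ)
         (step : ∀ k s → a (suc k) s ≡ r ℚ.* sum (λ l → a k (τ s l))) where

  -- Averaging over the maps `τ` is linear, so it carries a relation valid at all states from time k
  -- to time k + 1.
  recurrence-shift : ∀ {n} (cs : Vec ℚ n) → (∀ s → apply cs (λ j → a j s) ≡ 0ℚ) →
    ∀ k s → apply cs (λ j → a (j ℕ.+ k) s) ≡ 0ℚ
  recurrence-shift cs rel zero    s =
    trans (apply-cong cs (λ j → cong (λ i → a i s) (ℕₚ.+-identityʳ j))) (rel s)
  recurrence-shift cs rel (suc k) s = begin
    apply cs (λ j → a (j ℕ.+ suc k) s)
      ≡⟨ apply-cong cs (λ j → trans (cong (λ i → a i s) (ℕₚ.+-suc j k)) (step (j ℕ.+ k) s)) ⟩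
    apply cs (λ j → r ℚ.* sum (λ l → a (j ℕ.+ k) (τ s l)))
      ≡⟨ apply-* cs r (λ j → sum (λ l → a (j ℕ.+ k) (τ s l))) ⟩
    r ℚ.* apply cs (λ j → sum (λ l → a (j ℕ.+ k) (τ s l)))
      ≡⟨ cong (r ℚ.*_) (apply-sum cs (λ l j → a (j ℕ.+ k) (τ s l))) ⟩
    r ℚ.* sum (λ l → apply cs (λ j → a (j ℕ.+ k) (τ s l)))
      ≡⟨ cong (r ℚ.*_) (trans (sum-cong-≗ (λ l → recurrence-shift cs rel k (τ s l))) (sum-replicate-zero m)) ⟩
    r ℚ.* 0ℚ
      ≡⟨ ℚₚ.*-zeroʳ r ⟩
    0ℚ ∎

  finite-state-limit-rational : (xs : List A) → (∀ t → t ∈ xs) →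
    ∀ s {x} → (λ k → a k s) ⇝ x → IsRational x
  finite-state-limit-rational xs complete s {x} lim =
    let (cs , nz , rel) = functions-dependent xs complete a
    in recurrent-limit-rational cs nz {λ k → a k s} {x} lim 0ℚ (λ k → recurrence-shift cs rel k s)

-- The forms at qm + l

module _ {q : ℕ} (2≤q : 2 ≤ q) where

  -- Ensures that every exponent k with q^k dividing a positive n lies in the range searched by `v`.
  n<q^n : ∀ n → n < q ^ n
  n<q^n n = ℕₚ.<-≤-trans (n<2^n n) (ℕₚ.^-monoˡ-≤ n 2≤q)
    where
    n<2^n : ∀ n → n < 2 ^ n
    n<2^n zero    = s≤s z≤n
    n<2^n (suc n) = ℕₚ.+-mono-≤ (ℕₚ.≤-trans (s≤s z≤n) (n<2^n n))
                      (ℕₚ.≤-trans (n<2^n n) (ℕₚ.m≤m+n (2 ^ n) 0))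

  v-divides : ∀ n .{{_ : NonZero n}} → q ^ v q n ∣ℕ n
  v-divides n@(suc _) with argmax-sel id 0 (filter (λ k → q ^ k ℕ∣.∣? n) (upTo (suc n)))
  -- The default value 0 of `max` is harmless because q^0 = 1 divides everything.
  ... | inj₁ eq = subst (λ k → q ^ k ∣ℕ n) (sym eq) (ℕ∣.1∣ n)
  ... | inj₂ m∈ = proj₂ (∈-filter⁻ (λ k → q ^ k ℕ∣.∣? n) {xs = upTo (suc n)} m∈)

  v-greatest : ∀ n .{{_ : NonZero n}} k → q ^ k ∣ℕ n → k ≤ v q n
  v-greatest n@(suc _) k q^k∣n = All.lookup (xs≤max 0 (filter dec (upTo (suc n))))
    (∈-filter⁺ dec (∈-upTo⁺ (ℕₚ.m≤n⇒m≤1+n (ℕₚ.<-≤-trans (n<q^n k) (ℕ∣.∣⇒≤ q^k∣n)))) q^k∣n)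
    where dec = λ k → q ^ k ℕ∣.∣? n

  v-multiple : ∀ m .{{_ : NonZero m}} → v q (q * m) ≡ suc (v q m)
  v-multiple m = ℕₚ.≤-antisym (bound (v q (q * m)) (v-divides (q * m)))
    (v-greatest (q * m) (suc (v q m)) (ℕ∣.*-monoʳ-∣ q (v-divides m)))
    where
    instance
      q≢0 : NonZero q
      q≢0 = ℕ.>-nonZero (ℕₚ.<-trans (s≤s z≤n) 2≤q)
      qm≢0 : NonZero (q * m)
      qm≢0 = ℕₚ.m*n≢0 q m
    bound : ∀ k → q ^ k ∣ℕ q * m → k ≤ suc (v q m)
    bound zero    _ = z≤n
    bound (suc k) h = s≤s (v-greatest m k (ℕ∣.*-cancelˡ-∣ q h))

  v-nonmultiple : ∀ m l → suc l < q → v q (q * m + suc l) ≡ 0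
  v-nonmultiple m l l<q = go (v q (q * m + suc l)) refl
    where
    instance
      n≢0 : NonZero (q * m + suc l)
      n≢0 = ℕ.>-nonZero (ℕₚ.≤-trans (s≤s z≤n) (ℕₚ.m≤n+m (suc l) (q * m)))
    go : ∀ k → v q (q * m + suc l) ≡ k → v q (q * m + suc l) ≡ 0
    go zero    eq = eq
    -- A positive valuation would make q divide qm + l + 1 and hence l + 1, which is positive and
    -- below q.
    go (suc k) eq = contradiction
      (ℕ∣.∣m+n∣m⇒∣n
        (ℕ∣.∣-trans (ℕ∣.m∣m*n (q ^ k))
          (subst (λ j → q ^ j ∣ℕ q * m + suc l) eq (v-divides (q * m + suc l))))
        (ℕ∣.m∣m*n m))
      (ℕ∣.>⇒∤ l<q)

-- The sum form allows induction without division; `triangular-closed` relates it to the quotient by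
-- 2 in `form`.
triangular : ℕ → ℕ
triangular n = Σ[0⋯ n ] id

2*triangular : ∀ n → n * suc n ≡ triangular n * 2
2*triangular zero    = refl
2*triangular (suc n) = begin
  suc n * suc (suc n)   ≡⟨ lem n ⟩
  n * suc n + suc n * 2 ≡⟨ cong (_+ suc n * 2) (2*triangular n) ⟩
  triangular n * 2 + suc n * 2   ≡⟨ ℕₚ.*-distribʳ-+ 2 (triangular n) (suc n) ⟨
  triangular (suc n) * 2         ∎
  where
  lem : ∀ n → suc n * suc (suc n) ≡ n * suc n + suc n * 2
  lem = ℕSolver.solve-∀

triangular-closed : ∀ n → n * suc n ℕ./ 2 ≡ triangular n
triangular-closed n = trans (cong (ℕ._/ 2) (2*triangular n)) (ℕDM.m*n/n≡m (triangular n) 2)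

-- After doubling, a polynomial identity. The term with `triangular p`, which is q(q - 1)/2, stands
-- on the left to avoid subtraction in ℕ. This yields the third row of M_λ.
triangular-step : ∀ p m l → let q = suc p in
  triangular (q * m + l) + triangular p * m ≡ q * q * triangular m + l * q * m + triangular l
triangular-step p m l = ℕₚ.*-cancelʳ-≡ _ _ 2 (begin
  (triangular n + triangular p * m) * 2                            ≡⟨ e₁ (triangular n) (triangular p) m ⟩
  triangular n * 2 + triangular p * 2 * m
    ≡⟨ cong₂ (λ x y → x + y * m) (2*triangular n) (2*triangular p) ⟨
  n * suc n + p * suc p * m                      ≡⟨ e₂ p m l ⟩
  q * q * (m * suc m) + 2 * (l * q * m) + l * suc l
    ≡⟨ cong₂ (λ x y → q * q * x + 2 * (l * q * m) + y) (2*triangular m) (2*triangular l) ⟩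
  q * q * (triangular m * 2) + 2 * (l * q * m) + triangular l * 2
    ≡⟨ e₃ (q * q) (triangular m) (l * q * m) (triangular l) ⟩
  (q * q * triangular m + l * q * m + triangular l) * 2            ∎)
  where
  q = suc p
  n = q * m + l
  e₁ : ∀ a b m → (a + b * m) * 2 ≡ a * 2 + b * 2 * m
  e₁ = ℕSolver.solve-∀
  e₂ : ∀ p m l → (suc p * m + l) * suc (suc p * m + l) + p * suc p * m
     ≡ suc p * suc p * (m * suc m) + 2 * (l * suc p * m) + l * suc l
  e₂ = ℕSolver.solve-∀
  e₃ : ∀ a b c e → a * (b * 2) + 2 * c + e * 2 ≡ (a * b + c + e) * 2
  e₃ = ℕSolver.solve-∀

-- Valuation sums at qm + l

module _ (p : ℕ) (2≤q : 2 ≤ suc p) where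

  private
    q = suc p

    -- The predecessor of q(m + 1) has last digit p = q - 1; the inductions below use this to pass
    -- from one block of q integers to the next.
    carry : ∀ m → q * suc m ≡ suc (q * m + p)
    carry = lem p
      where
      lem : ∀ p m → suc p * suc m ≡ suc (suc p * m + p)
      lem = ℕSolver.solve-∀

  -- Only multiples of q contribute to the sum, and `v-multiple` gives each of the m positive ones
  -- up to qm + l one unit more than its quotient by q. The induction is lexicographic in m and l.
  w-step : ∀ m l → l < q → w q (q * m + l) ≡ w q m + m
  w-step zero zero _ = cong (w q) (trans (ℕₚ.+-identityʳ (q * 0)) (ℕₚ.*-zeroʳ q))
  w-step (suc m) zero _ = begin
    w q (q * suc m + 0)                    ≡⟨ cong (w q) (trans (ℕₚ.+-identityʳ _) (carry m)) ⟩
    w q (q * m + p) + v q (suc (q * m + p)) ≡⟨ cong₂ _+_ (w-step m p ℕₚ.≤-refl) (cong (v q) (sym (carry m))) ⟩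
    w q m + m + v q (q * suc m)            ≡⟨ cong (w q m + m +_) (v-multiple 2≤q (suc m)) ⟩
    w q m + m + suc (v q (suc m))          ≡⟨ lem (w q m) m (v q (suc m)) ⟩
    w q m + v q (suc m) + suc m            ∎
    where
    lem : ∀ a m b → a + m + suc b ≡ a + b + suc m
    lem = ℕSolver.solve-∀
  w-step m (suc l) l<q = begin
    w q (q * m + suc l)                     ≡⟨ cong (w q) (ℕₚ.+-suc (q * m) l) ⟩
    w q (q * m + l) + v q (suc (q * m + l)) ≡⟨ cong₂ _+_ (w-step m l (ℕₚ.<-trans (ℕₚ.n<1+n l) l<q))
         (cong (v q) (sym (ℕₚ.+-suc (q * m) l))) ⟩
    w q m + m + v q (q * m + suc l)         ≡⟨ cong (w q m + m +_) (v-nonmultiple 2≤q m l l<q) ⟩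
    w q m + m + 0                           ≡⟨ ℕₚ.+-identityʳ _ ⟩
    w q m + m                               ∎

  -- By `w-step` each full block i < m contributes q(w(i) + i), and the last, partial block
  -- contributes (l + 1)(w(m) + m). Completing the sums to include i = m creates the negative terms,
  -- which are moved to the left.
  u-step : ∀ m l → l < q →
    u q (q * m + l) + (q * w q m + q * m) ≡ q * u q m + suc l * w q m + q * triangular m + suc l * m
  u-step zero zero _ = begin
    u q (q * 0 + 0) + (q * 0 + q * 0)
      ≡⟨ cong (λ n → u q n + (q * 0 + q * 0)) (trans (ℕₚ.+-identityʳ (q * 0)) (ℕₚ.*-zeroʳ q)) ⟩
    q * 0 + q * 0                     ≡⟨ lem q ⟩
    q * 0 + 1 * 0 + q * 0 + 1 * 0     ∎
    where
    lem : ∀ q → q * 0 + q * 0 ≡ q * 0 + 1 * 0 + q * 0 + 1 * 0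
    lem = ℕSolver.solve-∀
  -- The term added and cancelled here is the left-hand correction of the induction hypothesis at m.
  u-step (suc m) zero _ = ℕₚ.+-cancelʳ-≡ (q * w q m + q * m) _ _ (begin
    u q (q * suc m + 0) + X + Y         ≡⟨ cong (λ n → u q n + X + Y) (trans (ℕₚ.+-identityʳ _) (carry m)) ⟩
    u q (q * m + p) + w q (suc (q * m + p)) + X + Y
      ≡⟨ cong (λ n → u q (q * m + p) + n + X + Y) w-next ⟩
    u q (q * m + p) + (w′ + suc m) + X + Y
      ≡⟨ e₁ (u q (q * m + p)) (w′ + suc m) X Y ⟩
    (u q (q * m + p) + Y) + (w′ + suc m) + X
      ≡⟨ cong (λ z → z + (w′ + suc m) + X) (u-step m p ℕₚ.≤-refl) ⟩
    q * u q m + q * w q m + q * triangular m + q * m + (w′ + suc m) + X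
      ≡⟨ e₂ q m (u q m) (w q m) w′ (triangular m) ⟩
    q * (u q m + w′) + 1 * w′ + q * (triangular m + suc m) + 1 * suc m + Y ∎)
    where
    w′ = w q (suc m)
    X = q * w′ + q * suc m
    Y = q * w q m + q * m
    w-next : w q (suc (q * m + p)) ≡ w′ + suc m
    w-next = trans (cong (w q) (sym (trans (ℕₚ.+-identityʳ _) (carry m)))) (w-step (suc m) 0 (s≤s z≤n))
    e₁ : ∀ a b x y → a + b + x + y ≡ (a + y) + b + x
    e₁ = ℕSolver.solve-∀
    e₂ : ∀ q m a b c t → q * a + q * b + q * t + q * m + (c + suc m) + (q * c + q * suc m)
       ≡ q * (a + c) + 1 * c + q * (t + suc m) + 1 * suc m + (q * b + q * m)
    e₂ = ℕSolver.solve-∀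
  u-step m (suc l) l<q = begin
    u q (q * m + suc l) + Y               ≡⟨ cong (λ n → u q n + Y) (ℕₚ.+-suc (q * m) l) ⟩
    u q (q * m + l) + w q (suc (q * m + l)) + Y
      ≡⟨ cong (λ n → u q (q * m + l) + n + Y) (trans (cong (w q) (sym (ℕₚ.+-suc (q * m) l))) (w-step m (suc l) l<q)) ⟩
    u q (q * m + l) + (w q m + m) + Y     ≡⟨ e₁ (u q (q * m + l)) (w q m + m) Y ⟩
    u q (q * m + l) + Y + (w q m + m)     ≡⟨ cong (_+ (w q m + m)) (u-step m l (ℕₚ.<-trans (ℕₚ.n<1+n l) l<q)) ⟩
    q * u q m + suc l * w q m + q * triangular m + suc l * m + (w q m + m)
      ≡⟨ e₂ q m l (u q m) (w q m) (triangular m) ⟩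
    q * u q m + suc (suc l) * w q m + q * triangular m + suc (suc l) * m ∎
    where
    Y = q * w q m + q * m
    e₁ : ∀ a b y → a + b + y ≡ a + y + b
    e₁ = ℕSolver.solve-∀
    e₂ : ∀ q m l a b t → q * a + suc l * b + q * t + suc l * m + (b + m)
       ≡ q * a + suc (suc l) * b + q * t + suc (suc l) * m
    e₂ = ℕSolver.solve-∀

-- The integer form and the matrices M_λ

dot : ∀ {n} → Vec ℤ n → Vec ℤ n → ℤ
dot []       []       = ℤ.+ 0
dot (x ∷ xs) (y ∷ ys) = x ℤ.* y ℤ.+ dot xs ys

_·ᴹ_ : ∀ {m n} → Vec ℤ m → Vec (Vec ℤ n) m → Vec ℤ n
s ·ᴹ A = Vec.tabulate λ j → dot s (Vec.map (λ row → Vec.lookup row j) A)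

form-step : ∀ p → 2 ≤ suc p → ∀ s m l → l < suc p →
  form (suc p) s (suc p * m + l) ≡ form (suc p) (s ·ᴹ Mℤ (suc p) l) m
form-step p 2≤q (θu ∷ θw ∷ θ₂ ∷ θ₁ ∷ θ₀ ∷ []) m l l<q = begin
  θu ℤ.* ℤ.+ u q n ℤ.+ θw ℤ.* ℤ.+ w q n ℤ.+ θ₂ ℤ.* ℤ.+ (n * suc n ℕ./ 2)
    ℤ.+ θ₁ ℤ.* ℤ.+ n ℤ.+ θ₀
    ≡⟨ cong₂ (λ x y → θu ℤ.* x ℤ.+ θw ℤ.* y ℤ.+ θ₂ ℤ.* ℤ.+ (n * suc n ℕ./ 2)
         ℤ.+ θ₁ ℤ.* ℤ.+ n ℤ.+ θ₀) u-eq (trans (cong ℤ.+_ (w-step p 2≤q m l l<q)) (ℤₚ.pos-+ (w q m) m)) ⟩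
  _ ≡⟨ cong₂ (λ x y → θu ℤ.* (ℤ.+ q ℤ.* ℤ.+ u q m ℤ.+ (ℤ.+ 1 ℤ.+ ℤ.+ l) ℤ.* ℤ.+ w q m ℤ.+ ℤ.+ q ℤ.* t
         ℤ.+ (ℤ.+ 1 ℤ.+ ℤ.+ l) ℤ.* ℤ.+ m
         ℤ.- (ℤ.+ q ℤ.* ℤ.+ w q m ℤ.+ ℤ.+ q ℤ.* ℤ.+ m)) ℤ.+ θw ℤ.* (ℤ.+ w q m ℤ.+ ℤ.+ m) ℤ.+ θ₂ ℤ.* x
         ℤ.+ θ₁ ℤ.* y ℤ.+ θ₀) t-eq (trans (ℤₚ.pos-+ (q * m) l) (cong (ℤ._+ ℤ.+ l) (ℤₚ.pos-* q m))) ⟩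
  -- The quantities q², lq, q(q - 1)/2, l(l + 1)/2 and m(m + 1)/2 enter as independent variables.
  -- The zeros in `identity` reproduce what `dot` unfolds to on the columns of `Mℤ`.
  _ ≡⟨ identity θu θw θ₂ θ₁ θ₀ (ℤ.+ q) (ℤ.+ l) (ℤ.+ u q m) (ℤ.+ w q m) t (ℤ.+ m)
         (ℤ.+ (q ^ 2)) (ℤ.+ (l * q)) (ℤ.+ (q * p ℕ./ 2)) (ℤ.+ (l * suc l ℕ./ 2)) ⟩
  form q ((θu ∷ θw ∷ θ₂ ∷ θ₁ ∷ θ₀ ∷ []) ·ᴹ Mℤ q l) m ∎
  where
  q = suc p
  n = q * m + l
  t = ℤ.+ (m * suc m ℕ./ 2)
  -- Turns the subtraction-free identities in ℕ into the signed form of the matrix entries.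
  isolate : ∀ {a b c} → a + b ≡ c → ℤ.+ a ≡ ℤ.+ c ℤ.- ℤ.+ b
  isolate {a} {b} refl = trans (lem (ℤ.+ a) (ℤ.+ b)) (cong (ℤ._- ℤ.+ b) (sym (ℤₚ.pos-+ a b)))
    where
    lem : ∀ x y → x ≡ x ℤ.+ y ℤ.- y
    lem = ℤSolver.solve-∀
  u-eq : ℤ.+ u q n ≡ ℤ.+ q ℤ.* ℤ.+ u q m ℤ.+ (ℤ.+ 1 ℤ.+ ℤ.+ l) ℤ.* ℤ.+ w q m ℤ.+ ℤ.+ q ℤ.* t
    ℤ.+ (ℤ.+ 1 ℤ.+ ℤ.+ l) ℤ.* ℤ.+ m ℤ.- (ℤ.+ q ℤ.* ℤ.+ w q m ℤ.+ ℤ.+ q ℤ.* ℤ.+ m)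
  u-eq rewrite triangular-closed m = trans (isolate (u-step p 2≤q m l l<q)) (cong₂ ℤ._-_
    (trans (ℤₚ.pos-+ (q * u q m + suc l * w q m + q * triangular m) (suc l * m)) (cong₂ ℤ._+_
      (trans (ℤₚ.pos-+ (q * u q m + suc l * w q m) (q * triangular m)) (cong₂ ℤ._+_
        (trans (ℤₚ.pos-+ (q * u q m) (suc l * w q m)) (cong₂ ℤ._+_ (ℤₚ.pos-* q (u q m)) (ℤₚ.pos-* (suc l) (w q m))))
        (ℤₚ.pos-* q (triangular m))))
      (ℤₚ.pos-* (suc l) m)))
    (trans (ℤₚ.pos-+ (q * w q m) (q * m)) (cong₂ ℤ._+_ (ℤₚ.pos-* q (w q m)) (ℤₚ.pos-* q m))))
  t-eq : ℤ.+ (n * suc n ℕ./ 2) ≡ ℤ.+ (q ^ 2) ℤ.* t ℤ.+ ℤ.+ (l * q) ℤ.* ℤ.+ m ℤ.+ ℤ.+ (l * suc l ℕ./ 2)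
    ℤ.- ℤ.+ (q * p ℕ./ 2) ℤ.* ℤ.+ m
  t-eq = begin
    ℤ.+ (n * suc n ℕ./ 2)                 ≡⟨ cong ℤ.+_ (triangular-closed n) ⟩
    ℤ.+ triangular n                               ≡⟨ isolate (triangular-step p m l) ⟩
    ℤ.+ (q * q * triangular m + l * q * m + triangular l) ℤ.- ℤ.+ (triangular p * m)
      ≡⟨ cong₂ ℤ._-_
      (trans (ℤₚ.pos-+ (q * q * triangular m + l * q * m) (triangular l)) (cong (ℤ._+ ℤ.+ triangular l)
        (trans (ℤₚ.pos-+ (q * q * triangular m) (l * q * m)) (cong₂ ℤ._+_ (ℤₚ.pos-* (q * q) (triangular m)) (ℤₚ.pos-* (l * q) m)))))
      (ℤₚ.pos-* (triangular p) m) ⟩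
    ℤ.+ (q * q) ℤ.* ℤ.+ triangular m ℤ.+ ℤ.+ (l * q) ℤ.* ℤ.+ m ℤ.+ ℤ.+ triangular l ℤ.- ℤ.+ triangular p ℤ.* ℤ.+ m
      ≡⟨ cong₂ (λ x y → ℤ.+ (q * q) ℤ.* ℤ.+ x ℤ.+ ℤ.+ (l * q) ℤ.* ℤ.+ m ℤ.+ ℤ.+ y ℤ.- ℤ.+ triangular p ℤ.* ℤ.+ m)
           (triangular-closed m) (triangular-closed l) ⟨
    ℤ.+ (q * q) ℤ.* t ℤ.+ ℤ.+ (l * q) ℤ.* ℤ.+ m ℤ.+ ℤ.+ (l * suc l ℕ./ 2) ℤ.- ℤ.+ triangular p ℤ.* ℤ.+ m
      ≡⟨ cong₂ (λ x y → ℤ.+ (q * x) ℤ.* t ℤ.+ ℤ.+ (l * q) ℤ.* ℤ.+ m ℤ.+ ℤ.+ (l * suc l ℕ./ 2) ℤ.- ℤ.+ y ℤ.* ℤ.+ m)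
           (ℕₚ.*-identityʳ q) (trans (cong (ℕ._/ 2) (ℕₚ.*-comm q p)) (triangular-closed p)) ⟨
    ℤ.+ (q ^ 2) ℤ.* t ℤ.+ ℤ.+ (l * q) ℤ.* ℤ.+ m ℤ.+ ℤ.+ (l * suc l ℕ./ 2) ℤ.- ℤ.+ (q * p ℕ./ 2) ℤ.* ℤ.+ m ∎
  identity : ∀ θu θw θ₂ θ₁ θ₀ q l u w t m qq lq b tl →
    θu ℤ.* (q ℤ.* u ℤ.+ (ℤ.+ 1 ℤ.+ l) ℤ.* w ℤ.+ q ℤ.* t ℤ.+ (ℤ.+ 1 ℤ.+ l) ℤ.* m ℤ.- (q ℤ.* w ℤ.+ q ℤ.* m))
      ℤ.+ θw ℤ.* (w ℤ.+ m) ℤ.+ θ₂ ℤ.* (qq ℤ.* t ℤ.+ lq ℤ.* m ℤ.+ tl ℤ.- b ℤ.* m)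
      ℤ.+ θ₁ ℤ.* (q ℤ.* m ℤ.+ l) ℤ.+ θ₀
    ≡ (θu ℤ.* q ℤ.+ (θw ℤ.* ℤ.+ 0 ℤ.+ (θ₂ ℤ.* ℤ.+ 0 ℤ.+ (θ₁ ℤ.* ℤ.+ 0 ℤ.+ (θ₀ ℤ.* ℤ.+ 0 ℤ.+ ℤ.+ 0))))) ℤ.* u
      ℤ.+ (θu ℤ.* (l ℤ.- q ℤ.+ ℤ.+ 1) ℤ.+ (θw ℤ.* ℤ.+ 1 ℤ.+ (θ₂ ℤ.* ℤ.+ 0 ℤ.+ (θ₁ ℤ.* ℤ.+ 0 ℤ.+ (θ₀ ℤ.* ℤ.+ 0 ℤ.+ ℤ.+ 0))))) ℤ.* w
      ℤ.+ (θu ℤ.* q ℤ.+ (θw ℤ.* ℤ.+ 0 ℤ.+ (θ₂ ℤ.* qq ℤ.+ (θ₁ ℤ.* ℤ.+ 0 ℤ.+ (θ₀ ℤ.* ℤ.+ 0 ℤ.+ ℤ.+ 0))))) ℤ.* t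
      ℤ.+ (θu ℤ.* (l ℤ.- q ℤ.+ ℤ.+ 1) ℤ.+ (θw ℤ.* ℤ.+ 1 ℤ.+ (θ₂ ℤ.* (lq ℤ.- b) ℤ.+ (θ₁ ℤ.* q ℤ.+ (θ₀ ℤ.* ℤ.+ 0 ℤ.+ ℤ.+ 0))))) ℤ.* m
      ℤ.+ (θu ℤ.* ℤ.+ 0 ℤ.+ (θw ℤ.* ℤ.+ 0 ℤ.+ (θ₂ ℤ.* tl ℤ.+ (θ₁ ℤ.* l ℤ.+ (θ₀ ℤ.* ℤ.+ 1 ℤ.+ ℤ.+ 0)))))
  identity = ℤSolver.solve-∀

-- Congruence modulo d

module _ (d : ℕ) where

  infix 4 _≈_
  -- A record keeps `a` and `b` inferable from the type, which the difference a - b alone would not.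
  record _≈_ (a b : ℤ) : Set where
    constructor congruent
    field difference : ℤ.+ d ∣ℤ a ℤ.- b

  ≈-refl : ∀ {a} → a ≈ a
  ≈-refl {a} = congruent $ ℤ∣.divides (ℤ.+ 0) (ℤₚ.+-inverseʳ a)

  ≈-trans : ∀ {a b c} → a ≈ b → b ≈ c → a ≈ c
  ≈-trans {a} {b} {c} (congruent p) (congruent r) = congruent $ subst (ℤ.+ d ∣ℤ_) (lem a b c) (ℤ∣.∣m∣n⇒∣m+n p r)
    where
    lem : ∀ a b c → (a ℤ.- b) ℤ.+ (b ℤ.- c) ≡ a ℤ.- c
    lem = ℤSolver.solve-∀

  ≈-+ : ∀ {a b a′ b′} → a ≈ a′ → b ≈ b′ → a ℤ.+ b ≈ a′ ℤ.+ b′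
  ≈-+ {a} {b} {a′} {b′} (congruent p) (congruent r) = congruent $ subst (ℤ.+ d ∣ℤ_) (lem a b a′ b′) (ℤ∣.∣m∣n⇒∣m+n p r)
    where
    lem : ∀ a b a′ b′ → (a ℤ.- a′) ℤ.+ (b ℤ.- b′) ≡ a ℤ.+ b ℤ.- (a′ ℤ.+ b′)
    lem = ℤSolver.solve-∀

  ≈-* : ∀ {a b a′ b′} → a ≈ a′ → b ≈ b′ → a ℤ.* b ≈ a′ ℤ.* b′
  ≈-* {a} {b} {a′} {b′} (congruent p) (congruent r) = congruent $ subst (ℤ.+ d ∣ℤ_) (lem a b a′ b′)
    (ℤ∣.∣m∣n⇒∣m+n (ℤ∣.∣m⇒∣m*n b p) (ℤ∣.∣n⇒∣m*n a′ r))
    where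
    lem : ∀ a b a′ b′ → (a ℤ.- a′) ℤ.* b ℤ.+ a′ ℤ.* (b ℤ.- b′) ≡ a ℤ.* b ℤ.- a′ ℤ.* b′
    lem = ℤSolver.solve-∀

  ≈-∣ : ∀ {a b} → a ≈ b → ℤ.+ d ∣ℤ a ⇔ ℤ.+ d ∣ℤ b
  ≈-∣ {a} {b} (congruent p) = mk⇔
    (λ h → subst (ℤ.+ d ∣ℤ_) (lem a b) (ℤ∣.∣m∣n⇒∣m-n h p))
    (λ h → subst (ℤ.+ d ∣ℤ_) (lem′ a b) (ℤ∣.∣m∣n⇒∣m+n p h))
    where
    lem : ∀ a b → a ℤ.- (a ℤ.- b) ≡ b
    lem = ℤSolver.solve-∀
    lem′ : ∀ a b → (a ℤ.- b) ℤ.+ b ≡ a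
    lem′ = ℤSolver.solve-∀

  form-cong : ∀ q (s t : Vec ℤ 5) → (∀ j → Vec.lookup s j ≈ Vec.lookup t j) →
    ∀ n → form q s n ≈ form q t n
  form-cong q (_ ∷ _ ∷ _ ∷ _ ∷ _ ∷ []) (_ ∷ _ ∷ _ ∷ _ ∷ _ ∷ []) s≈t n =
    ≈-+ (≈-+ (≈-+ (≈-+
      (≈-* (s≈t Fin.zero) ≈-refl)
      (≈-* (s≈t (Fin.suc Fin.zero)) ≈-refl))
      (≈-* (s≈t (Fin.suc (Fin.suc Fin.zero))) ≈-refl))
      (≈-* (s≈t (Fin.suc (Fin.suc (Fin.suc Fin.zero)))) ≈-refl))
      (s≈t (Fin.suc (Fin.suc (Fin.suc (Fin.suc Fin.zero)))))

  module _ .{{_ : NonZero d}} where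

    rep-reduce : ∀ a → rep (reduce d a) ≈ a
    rep-reduce a = congruent $ ℤ∣.divides (ℤ.- (a ℤDM./ℕ d)) (begin
      ℤ.+ toℕ (reduce d a) ℤ.- a        ≡⟨ cong (λ k → ℤ.+ k ℤ.- a) (Finₚ.toℕ-fromℕ< (ℤDM.n%ℕd<d a d)) ⟩
      r ℤ.- a                           ≡⟨ cong (λ z → r ℤ.- z) (ℤDM.a≡a%ℕn+[a/ℕn]*n a d) ⟩
      r ℤ.- (r ℤ.+ a ℤDM./ℕ d ℤ.* ℤ.+ d) ≡⟨ lem r (a ℤDM./ℕ d) (ℤ.+ d) ⟩
      ℤ.- (a ℤDM./ℕ d) ℤ.* ℤ.+ d        ∎)
      where
      r = ℤ.+ (a ℤDM.%ℕ d)
      lem : ∀ r k d → r ℤ.- (r ℤ.+ k ℤ.* d) ≡ ℤ.- k ℤ.* d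
      lem = ℤSolver.solve-∀

    -- Reducing after every addition and multiplication does not change the residue class of the
    -- result.
    rep-dot : ∀ {n} (s : Vec (Fin d) n) (ys : Vec ℤ n) →
      rep (Vec.foldr′ _⊕_ (reduce d (ℤ.+ 0)) (Vec.zipWith _⊗_ s (Vec.map (reduce d) ys)))
        ≈ dot (Vec.map rep s) ys
    rep-dot []      []       = rep-reduce (ℤ.+ 0)
    rep-dot (x ∷ s) (y ∷ ys) = ≈-trans (rep-reduce _) (≈-+
      (≈-trans (rep-reduce _) (≈-* (≈-refl {rep x}) (rep-reduce y)))
      (rep-dot s ys))

    rep-⊛ : ∀ q (s : State d) (l : Fin q) j →
      Vec.lookup (Vec.map rep (s ⊛ M q d l)) j ≈ Vec.lookup (Vec.map rep s ·ᴹ Mℤ q (toℕ l)) j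
    rep-⊛ q s l j = subst₂ _≈_ (sym (trans (Vecₚ.lookup-map j rep (s ⊛ M q d l)) (cong rep
        (Vecₚ.lookup∘tabulate (λ i → Vec.foldr′ _⊕_ (reduce d (ℤ.+ 0))
        (Vec.zipWith _⊗_ s (Vec.map (λ row → Vec.lookup row i) (M q d l)))) j))))
      (sym (Vecₚ.lookup∘tabulate (λ i → dot (Vec.map rep s) (column i)) j))
      (subst (λ c → rep (Vec.foldr′ _⊕_ (reduce d (ℤ.+ 0)) (Vec.zipWith _⊗_ s c)) ≈ dot (Vec.map rep s) (column j))
        (column-reduce j) (rep-dot s (column j)))
      where
      column : Fin 5 → Vec ℤ 5
      column j = Vec.map (λ row → Vec.lookup row j) (Mℤ q (toℕ l))
      column-reduce : ∀ j → Vec.map (reduce d) (column j) ≡ Vec.map (λ row → Vec.lookup row j) (M q d l)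
      column-reduce j = begin
        Vec.map (reduce d) (column j) ≡⟨ Vecₚ.map-∘ (reduce d) (λ row → Vec.lookup row j) (Mℤ q (toℕ l)) ⟨
        Vec.map (λ row → reduce d (Vec.lookup row j)) (Mℤ q (toℕ l))
          ≡⟨ Vecₚ.map-cong (λ row → sym (Vecₚ.lookup-map j (reduce d) row)) (Mℤ q (toℕ l)) ⟩
        Vec.map (λ row → Vec.lookup (Vec.map (reduce d) row) j) (Mℤ q (toℕ l))
          ≡⟨ Vecₚ.map-∘ (λ row → Vec.lookup row j) (Vec.map (reduce d)) (Mℤ q (toℕ l)) ⟩
        Vec.map (λ row → Vec.lookup row j) (M q d l) ∎

    -- Over ℤ the two forms agree by `form-step`; replacing the integer row by its residues changes
    -- the value only by a multiple of d.
    solution-step : ∀ q → 2 ≤ q → ∀ (s : State d) m (l : Fin q) →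
      ℤ.+ d ∣ℤ form q (Vec.map rep s) (q * m + toℕ l) ⇔ ℤ.+ d ∣ℤ form q (Vec.map rep (s ⊛ M q d l)) m
    solution-step q@(suc p) 2≤q s m l rewrite form-step p 2≤q (Vec.map rep s) m (toℕ l) (Finₚ.toℕ<n l) =
      mk⇔ (Equivalence.from eqv) (Equivalence.to eqv)
      where
      eqv = ≈-∣ (form-cong q (Vec.map rep (s ⊛ M q d l)) (Vec.map rep s ·ᴹ Mℤ q (toℕ l)) (rep-⊛ q s l) m)

-- Counting

-- The Iverson bracket.
⟦_⟧ : ∀ {a} {A : Set a} → Dec A → ℕ
⟦ a? ⟧ = if does a? then 1 else 0

⟦⟧-cong : ∀ {a b} {A : Set a} {B : Set b} → A ⇔ B → (a? : Dec A) (b? : Dec B) → ⟦ a? ⟧ ≡ ⟦ b? ⟧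
⟦⟧-cong _   (yes _) (yes _) = refl
⟦⟧-cong _   (no _)  (no _)  = refl
⟦⟧-cong A⇔B (yes a) (no ¬b) = contradiction (Equivalence.to A⇔B a) ¬b
⟦⟧-cong A⇔B (no ¬a) (yes b) = contradiction (Equivalence.from A⇔B b) ¬a

module _ {a p} {A : Set a} {P : Pred A p} (P? : Decidable P) where

  length-filter-∷ : ∀ x xs → length (filter P? (x ∷ xs)) ≡ ⟦ P? x ⟧ ℕ.+ length (filter P? xs)
  length-filter-∷ x xs with does (P? x)
  ... | true  = refl
  ... | false = refl

  length-filter-tabulate : ∀ {n} (f : Fin n → A) →
    length (filter P? (List.tabulate f)) ≡ ℕΣ.sum (λ i → ⟦ P? (f i) ⟧)
  length-filter-tabulate {zero}  f = refl
  length-filter-tabulate {suc n} f = trans (length-filter-∷ (f Fin.zero) (List.tabulate (f ∘ Fin.suc)))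
    (cong (⟦ P? (f Fin.zero) ⟧ ℕ.+_) (length-filter-tabulate (f ∘ Fin.suc)))

module _ {p} {P : Pred ℕ p} (P? : Decidable P) where

  -- `γ` is an instance of this by definition, which `γ-step` relies on.
  count : ℕ → ℕ
  count n = length (filter P? (upTo n))

  count-suc : ∀ n → count (suc n) ≡ count n ℕ.+ ⟦ P? n ⟧
  count-suc n = begin
    length (filter P? (upTo (suc n)))               ≡⟨ cong (length ∘ filter P?) (Listₚ.upTo-∷ʳ n) ⟨
    length (filter P? (upTo n List.++ n ∷ []))      ≡⟨ cong length (Listₚ.filter-++ P? (upTo n) (n ∷ [])) ⟩
    length (filter P? (upTo n) List.++ filter P? (n ∷ [])) ≡⟨ Listₚ.length-++ (filter P? (upTo n)) ⟩
    count n ℕ.+ length (filter P? (n ∷ []))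
      ≡⟨ cong (count n ℕ.+_) (trans (length-filter-∷ P? n []) (ℕₚ.+-identityʳ _)) ⟩
    count n ℕ.+ ⟦ P? n ⟧ ∎

  count-+ : ∀ m n → count (m ℕ.+ n) ≡ count m ℕ.+ ℕΣ.sum {n} (λ i → ⟦ P? (m ℕ.+ toℕ i) ⟧)
  count-+ m zero    = trans (cong count (ℕₚ.+-identityʳ m)) (sym (ℕₚ.+-identityʳ (count m)))
  count-+ m (suc n) = begin
    count (m ℕ.+ suc n)                       ≡⟨ cong count (ℕₚ.+-suc m n) ⟩
    count (suc m ℕ.+ n)                       ≡⟨ count-+ (suc m) n ⟩
    count (suc m) ℕ.+ ℕΣ.sum {n} (λ i → ⟦ P? (suc m ℕ.+ toℕ i) ⟧)
      ≡⟨ cong₂ ℕ._+_ (count-suc m) (ℕΣ.sum-cong-≗ {n} (λ i → cong (λ k → ⟦ P? k ⟧) (sym (ℕₚ.+-suc m (toℕ i))))) ⟩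
    count m ℕ.+ ⟦ P? m ⟧ ℕ.+ ℕΣ.sum {n} (λ i → ⟦ P? (m ℕ.+ suc (toℕ i)) ⟧)
      ≡⟨ ℕₚ.+-assoc (count m) ⟦ P? m ⟧ _ ⟩
    count m ℕ.+ (⟦ P? m ⟧ ℕ.+ ℕΣ.sum {n} (λ i → ⟦ P? (m ℕ.+ suc (toℕ i)) ⟧))
      ≡⟨ cong (λ k → count m ℕ.+ (⟦ P? k ⟧ ℕ.+ ℕΣ.sum {n} (λ i → ⟦ P? (m ℕ.+ suc (toℕ i)) ⟧))) (ℕₚ.+-identityʳ m) ⟨
    count m ℕ.+ (⟦ P? (m ℕ.+ 0) ⟧ ℕ.+ ℕΣ.sum {n} (λ i → ⟦ P? (m ℕ.+ suc (toℕ i)) ⟧)) ∎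

-- Raising N by one adds the block of integers qN + l with l < q on the left, and the single
-- candidate N in each of the q counts on the right; `solution-step` matches them.
γ-step : ∀ q d .{{_ : NonZero d}} → 2 ≤ q → ∀ (s : State d) N →
  γ (q ℕ.* N) q d (Vec.map rep s) ≡ ℕΣ.sum (λ l → γ N q d (Vec.map rep (s ⊛ M q d l)))
γ-step q d 2≤q s zero = begin
  γ (q ℕ.* 0) q d (Vec.map rep s) ≡⟨ cong (λ N → γ N q d (Vec.map rep s)) (ℕₚ.*-zeroʳ q) ⟩
  0                               ≡⟨ ℕΣ.sum-replicate-zero q ⟨
  ℕΣ.sum {q} (λ _ → 0)            ∎
γ-step q d 2≤q s (suc N) = begin
  γ (q ℕ.* suc N) q d (Vec.map rep s)
    ≡⟨ cong (λ N → γ N q d (Vec.map rep s)) (trans (ℕₚ.*-suc q N) (ℕₚ.+-comm q (q ℕ.* N))) ⟩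
  γ (q ℕ.* N ℕ.+ q) q d (Vec.map rep s)
    ≡⟨ count-+ (P? s) (q ℕ.* N) q ⟩
  γ (q ℕ.* N) q d (Vec.map rep s) ℕ.+ ℕΣ.sum {q} (λ l → ⟦ P? s (q ℕ.* N ℕ.+ toℕ l) ⟧)
    ≡⟨ cong₂ ℕ._+_ (γ-step q d 2≤q s N)
         (ℕΣ.sum-cong-≗ (λ l → ⟦⟧-cong (solution-step d q 2≤q s N l) (P? s (q ℕ.* N ℕ.+ toℕ l)) (P? (s ⊛ M q d l) N))) ⟩
  ℕΣ.sum (λ l → γ N q d (Vec.map rep (s ⊛ M q d l))) ℕ.+ ℕΣ.sum (λ l → ⟦ P? (s ⊛ M q d l) N ⟧)
    ≡⟨ ℕΣ.∑-distrib-+ (λ l → γ N q d (Vec.map rep (s ⊛ M q d l))) (λ l → ⟦ P? (s ⊛ M q d l) N ⟧) ⟨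
  ℕΣ.sum (λ l → γ N q d (Vec.map rep (s ⊛ M q d l)) ℕ.+ ⟦ P? (s ⊛ M q d l) N ⟧)
    ≡⟨ ℕΣ.sum-cong-≗ (λ l → sym (count-suc (P? (s ⊛ M q d l)) N)) ⟩
  ℕΣ.sum (λ l → γ (suc N) q d (Vec.map rep (s ⊛ M q d l))) ∎
  where
  P? : (s : State d) → Decidable (λ n → ℤ.+ d ∣ℤ form q (Vec.map rep s) n)
  P? s n = ℤ.+ d ℤ∣.∣? form q (Vec.map rep s) n

-- Fractions with natural denominators

/-* : ∀ a b m n .{{_ : NonZero m}} .{{_ : NonZero n}} .{{_ : NonZero (m ℕ.* n)}} →
  (a ℚ./ m) ℚ.* (b ℚ./ n) ≡ (a ℤ.* b) ℚ./ (m ℕ.* n)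
-- Normalised fractions do not reduce for variable arguments, so both sides are compared as
-- unnormalised ones.
/-* a b (suc m) (suc n) = ℚₚ.toℚᵘ-injective (ℚᵘₚ.≃-trans (ℚₚ.toℚᵘ-homo-* (a ℚ./ suc m) (b ℚ./ suc n))
  (ℚᵘₚ.≃-trans (ℚᵘₚ.*-cong (ℚₚ.toℚᵘ-fromℚᵘ (mkℚᵘ a m)) (ℚₚ.toℚᵘ-fromℚᵘ (mkℚᵘ b n)))
    (ℚᵘₚ.≃-sym (ℚₚ.toℚᵘ-fromℚᵘ (mkℚᵘ a m ℚᵘ.* mkℚᵘ b n)))))

/-+ : ∀ a b n .{{_ : NonZero n}} → (a ℚ./ n) ℚ.+ (b ℚ./ n) ≡ (a ℤ.+ b) ℚ./ n
/-+ a b (suc n) = ℚₚ.toℚᵘ-injective (ℚᵘₚ.≃-trans (ℚₚ.toℚᵘ-homo-+ (a ℚ./ suc n) (b ℚ./ suc n))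
  (ℚᵘₚ.≃-trans (ℚᵘₚ.+-cong (ℚₚ.toℚᵘ-fromℚᵘ (mkℚᵘ a n)) (ℚₚ.toℚᵘ-fromℚᵘ (mkℚᵘ b n)))
    (ℚᵘₚ.≃-trans (*≡* (lem a b (ℤ.+ suc n)))
      (ℚᵘₚ.≃-sym (ℚₚ.toℚᵘ-fromℚᵘ (mkℚᵘ (a ℤ.+ b) n))))))
  where
  lem : ∀ a b n → (a ℤ.* n ℤ.+ b ℤ.* n) ℤ.* n ≡ (a ℤ.+ b) ℤ.* (n ℤ.* n)
  lem = ℤSolver.solve-∀

sum-/ : ∀ {m} (g : Fin m → ℕ) n .{{_ : NonZero n}} →
  sum (λ i → ℤ.+ g i ℚ./ n) ≡ ℤ.+ ℕΣ.sum g ℚ./ n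
sum-/ {zero}  g n = sym (ℚₚ.0/n≡0 n)
sum-/ {suc m} g n = begin
  ℤ.+ g Fin.zero ℚ./ n ℚ.+ sum (λ i → ℤ.+ g (Fin.suc i) ℚ./ n)
    ≡⟨ cong (ℤ.+ g Fin.zero ℚ./ n ℚ.+_) (sum-/ (g ∘ Fin.suc) n) ⟩
  ℤ.+ g Fin.zero ℚ./ n ℚ.+ ℤ.+ ℕΣ.sum (g ∘ Fin.suc) ℚ./ n
    ≡⟨ /-+ (ℤ.+ g Fin.zero) (ℤ.+ ℕΣ.sum (g ∘ Fin.suc)) n ⟩
  (ℤ.+ g Fin.zero ℤ.+ ℤ.+ ℕΣ.sum (g ∘ Fin.suc)) ℚ./ n
    ≡⟨ ℚₚ./-cong (sym (ℤₚ.pos-+ (g Fin.zero) (ℕΣ.sum (g ∘ Fin.suc)))) refl ⟩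
  ℤ.+ ℕΣ.sum g ℚ./ n ∎

-- Matrix rows as averages over digits

allVecs-unique : ∀ d n → Unique (allVecs d n)
allVecs-unique d zero    = [] ∷ []
allVecs-unique d (suc n) = cartesianProductWith⁺ _∷_ Vecₚ.∷-injective (allFin⁺ d) (allVecs-unique d n)

∈-allVecs : ∀ {d n} (t : Vec (Fin d) n) → t ∈ allVecs d n
∈-allVecs []      = here refl
∈-allVecs (x ∷ t) = ∈-cartesianProductWith⁺ _∷_ (∈-allFin x) (∈-allVecs t)

seq-combination : ∀ {a} {A : Set a} (c : A → ℚ) (x : A → ℝ) xs n →
  seq (sumᴿ (List.map (λ t → c t • x t) xs)) n
    ≡ sum (λ i → c (List.lookup xs i) ℚ.* seq (x (List.lookup xs i)) n)
seq-combination c x []       n = refl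
seq-combination c x (t ∷ xs) n = cong (c t ℚ.* seq (x t) n ℚ.+_) (seq-combination c x xs n)

module _ {a} {A : Set a} (_≟_ : (x y : A) → Dec (x ≡ y)) where

  -- Written as a count over 1 so that `sum-/` converts sums of these into counts, as `P-entry`
  -- requires.
  kronecker : A → A → ℚ
  kronecker x y = ℤ.+ ⟦ x ≟ y ⟧ ℚ./ 1

  kronecker-refl : ∀ x → kronecker x x ≡ 1ℚ
  kronecker-refl x with x ≟ x
  ... | yes _   = refl
  ... | no x≢x = contradiction refl x≢x

  kronecker-≢ : ∀ {x y} → x ≢ y → kronecker x y ≡ 0ℚ
  kronecker-≢ {x} {y} x≢y with x ≟ y
  ... | yes x≡y = contradiction x≡y x≢y
  ... | no _    = refl

  sum-kronecker-∉ : ∀ (g : A → ℚ) {y} xs → All (y ≢_) xs →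
    sum (λ i → kronecker (List.lookup xs i) y ℚ.* g (List.lookup xs i)) ≡ 0ℚ
  sum-kronecker-∉ g []       []            = refl
  sum-kronecker-∉ g (x ∷ xs) (y≢x ∷ y∉xs) = cong₂ ℚ._+_
    (trans (cong (ℚ._* g x) (kronecker-≢ (y≢x ∘ sym))) (ℚₚ.*-zeroˡ (g x))) (sum-kronecker-∉ g xs y∉xs)

  sum-kronecker : ∀ (g : A → ℚ) {y} xs → Unique xs → y ∈ xs →
    sum (λ i → kronecker (List.lookup xs i) y ℚ.* g (List.lookup xs i)) ≡ g y
  sum-kronecker g (x ∷ xs) (x∉xs ∷ _) (here refl) = trans
    (cong₂ ℚ._+_ (trans (cong (ℚ._* g x) (kronecker-refl x)) (ℚₚ.*-identityˡ (g x))) (sum-kronecker-∉ g xs x∉xs))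
    (ℚₚ.+-identityʳ (g x))
  sum-kronecker g (x ∷ xs) (x∉xs ∷ unique) (there y∈xs) = trans
    (cong₂ ℚ._+_ (trans (cong (ℚ._* g x) (kronecker-≢ (All.lookup x∉xs y∈xs))) (ℚₚ.*-zeroˡ (g x)))
      (sum-kronecker g xs unique y∈xs))
    (ℚₚ.+-identityˡ _)

  module _ {xs : List A} (unique : Unique xs) (complete : ∀ t → t ∈ xs) {m} (τ : Fin m → A) {r : ℚ}
           (c : A → ℚ) (entry : ∀ t → c t ≡ r ℚ.* sum (λ l → kronecker t (τ l))) where

    private
      L = List.lookup xs

    -- Exchanging the sums over states and over digits leaves, for each digit l, a Kronecker sum
    -- that picks out the state `τ l`.
    sum-kronecker-image : ∀ (g : A → ℚ) → sum (λ i → c (L i) ℚ.* g (L i)) ≡ r ℚ.* sum (λ l → g (τ l))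
    sum-kronecker-image g = begin
      sum (λ i → c (L i) ℚ.* g (L i))
        ≡⟨ sum-cong-≗ (λ i → trans (cong (ℚ._* g (L i)) (entry (L i)))
             (trans (ℚₚ.*-assoc r (sum (λ l → kronecker (L i) (τ l))) (g (L i)))
               (cong (r ℚ.*_) (*-distribʳ-sum (g (L i)) (λ l → kronecker (L i) (τ l)))))) ⟩
      sum (λ i → r ℚ.* sum (λ l → kronecker (L i) (τ l) ℚ.* g (L i)))
        ≡⟨ *-distribˡ-sum r (λ i → sum (λ l → kronecker (L i) (τ l) ℚ.* g (L i))) ⟨
      r ℚ.* sum (λ i → sum (λ l → kronecker (L i) (τ l) ℚ.* g (L i)))
        ≡⟨ cong (r ℚ.*_) (∑-comm (λ i l → kronecker (L i) (τ l) ℚ.* g (L i))) ⟩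
      r ℚ.* sum (λ l → sum (λ i → kronecker (L i) (τ l) ℚ.* g (L i)))
        ≡⟨ cong (r ℚ.*_) (sum-cong-≗ (λ l → sum-kronecker g xs unique (complete (τ l)))) ⟩
      r ℚ.* sum (λ l → g (τ l)) ∎

    combination-of-image : ∀ (x : A → ℝ) y →
      Null (λ n → r ℚ.* sum (λ l → seq (x (τ l)) n) ℚ.- seq y n) →
      sumᴿ (List.map (λ t → c t • x t) xs) ≃ y
    combination-of-image x y = null-cong (λ n → cong (ℚ._- seq y n)
      (sym (trans (seq-combination c x xs n) (sum-kronecker-image (λ t → seq (x t) n)))))

-- Densities

_≟ˢ_ : ∀ {d} (s t : State d) → Dec (s ≡ t)
_≟ˢ_ = Vecₚ.≡-dec Finₚ._≟_

row-of-image : ∀ {d m} (A : State d → State d → ℚ) s (τ : Fin m → State d) r →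
  (∀ t → A s t ≡ r ℚ.* sum (λ l → kronecker _≟ˢ_ t (τ l))) → ∀ x y →
  Null (λ n → r ℚ.* sum (λ l → seq (x (τ l)) n) ℚ.- seq y n) → (A ·ᵛ x) s ≃ y
row-of-image {d} A s τ r entry x y =
  combination-of-image _≟ˢ_ (allVecs-unique d 5) ∈-allVecs τ {r} (A s) entry x y

module _ {q d : ℕ} .{{q≢0 : NonZero q}} .{{d≢0 : NonZero d}} (2≤q : 2 ≤ q) where

  private
    r = ℤ.+ 1 ℚ./ q

  -- The index n stands for the initial segment of length n + 1.
  frequency : State d → ℕ → ℚ
  frequency s k = ℤ.+ γ (suc k) q d (Vec.map rep s) ℚ./ suc k

  frequency-suc : ∀ s {k} N .{{_ : NonZero N}} → suc k ≡ N → frequency s k ≡ ℤ.+ γ N q d (Vec.map rep s) ℚ./ N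
  frequency-suc s _ refl = refl

  -- Index n has length n + 1, so multiplying the length by q leads to index q(n + 1) - 1.
  dilate : ℕ → ℕ
  dilate n = ℕ.pred (q ℕ.* suc n)

  suc-dilate : ∀ n → suc (dilate n) ≡ q ℕ.* suc n
  suc-dilate n = ℕₚ.suc-pred (q ℕ.* suc n) {{ℕₚ.m*n≢0 q (suc n)}}

  n<dilate : ∀ n → n < dilate n
  n<dilate n = ℕ.s≤s⁻¹ (subst (suc (suc n) ≤_) (sym (suc-dilate n))
    (ℕₚ.≤-trans (subst (_≤ 2 ℕ.* suc n) (ℕₚ.+-comm (suc n) 1) (ℕₚ.+-monoʳ-≤ (suc n) (s≤s z≤n)))
      (ℕₚ.*-monoˡ-≤ (suc n) 2≤q)))

  frequency-dilate : ∀ s n → frequency s (dilate n) ≡ r ℚ.* sum (λ l → frequency (s ⊛ M q d l) n)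
  frequency-dilate s n = begin
    frequency s (dilate n)
      ≡⟨ frequency-suc s (q ℕ.* suc n) (suc-dilate n) ⟩
    ℤ.+ γ (q ℕ.* suc n) q d (Vec.map rep s) ℚ./ (q ℕ.* suc n)
      ≡⟨ cong (ℚ._/ (q ℕ.* suc n)) (trans (cong ℤ.+_ (γ-step q d 2≤q s (suc n))) (sym (ℤₚ.*-identityˡ _))) ⟩
    (ℤ.+ 1 ℤ.* ℤ.+ ℕΣ.sum g) ℚ./ (q ℕ.* suc n)
      ≡⟨ /-* (ℤ.+ 1) (ℤ.+ ℕΣ.sum g) q (suc n) ⟨
    r ℚ.* (ℤ.+ ℕΣ.sum g ℚ./ suc n)
      ≡⟨ cong (r ℚ.*_) (sum-/ g (suc n)) ⟨
    r ℚ.* sum (λ l → frequency (s ⊛ M q d l) n) ∎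
    where
    g : Fin q → ℕ
    g l = γ (suc n) q d (Vec.map rep (s ⊛ M q d l))
    instance
      qn≢0 : NonZero (q ℕ.* suc n)
      qn≢0 = ℕₚ.m*n≢0 q (suc n)

  -- Index 0 has length 1, so after k dilations the length is q^k and the frequency there is a_k(s).
  dilateᵏ : ℕ → ℕ
  dilateᵏ zero    = 0
  dilateᵏ (suc k) = dilate (dilateᵏ k)

  k≤dilateᵏ : ∀ k → k ≤ dilateᵏ k
  k≤dilateᵏ zero    = z≤n
  k≤dilateᵏ (suc k) = ℕₚ.≤-<-trans (k≤dilateᵏ k) (n<dilate (dilateᵏ k))

  P-entry : ∀ s t → P q d s t ≡ r ℚ.* sum (λ l → kronecker _≟ˢ_ t (s ⊛ M q d l))
  P-entry s t = begin
    ℤ.+ μ q d s t ℚ./ q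
      -- The fraction is rewritten over q · 1 so that `/-*` can split off the factor 1/q.
      ≡⟨ ℚₚ./-cong (trans (cong ℤ.+_ (length-filter-tabulate hit? id)) (sym (ℤₚ.*-identityˡ _)))
           (sym (ℕₚ.*-identityʳ q)) ⟩
    (ℤ.+ 1 ℤ.* ℤ.+ ℕΣ.sum (λ l → ⟦ hit? l ⟧)) ℚ./ (q ℕ.* 1)
      ≡⟨ /-* (ℤ.+ 1) (ℤ.+ ℕΣ.sum (λ l → ⟦ hit? l ⟧)) q 1 ⟨
    r ℚ.* (ℤ.+ ℕΣ.sum (λ l → ⟦ hit? l ⟧) ℚ./ 1)
      ≡⟨ cong (r ℚ.*_) (sum-/ (λ l → ⟦ hit? l ⟧) 1) ⟨
    r ℚ.* sum (λ l → ℤ.+ ⟦ hit? l ⟧ ℚ./ 1) ∎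
    where
    hit? : ∀ l → Dec (t ≡ s ⊛ M q d l)
    hit? l = t ≟ˢ (s ⊛ M q d l)
    instance
      q*1≢0 : NonZero (q ℕ.* 1)
      q*1≢0 = ℕₚ.m*n≢0 q 1

  module _ (f : State d → ℕ → ℚ) (f-dilate : ∀ s n → f s (dilate n) ≡ r ℚ.* sum (λ l → f (s ⊛ M q d l) n))
           (δ : State d → ℝ) (density : ∀ s → f s ⇝ δ s) where

    -- Along dilated indices the frequencies at s still tend to `δ s`, while by `f-dilate` they are
    -- averages whose terms tend to the densities of the successor states.
    P-fixes-density : ∀ s → (P q d {{q≢0}} {{d≢0}} ·ᵛ δ) s ≃ δ s
    P-fixes-density s = row-of-image (P q d {{q≢0}} {{d≢0}}) s (λ l → s ⊛ M q d l) r (P-entry s) δ (δ s)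
      (limit-of-average r (λ l → f (s ⊛ M q d l)) (λ l → δ (s ⊛ M q d l))
        (λ l → density (s ⊛ M q d l)) {f s ∘ dilate} {δ s} (f-dilate s)
        (⇝-reindex {f s} {δ s} dilate (λ n → ℕₚ.<⇒≤ (n<dilate n)) (density s)))

    -- Sampling at the indices `dilateᵏ k` gives a sequence of vectors in which each is the average
    -- of the previous one over successor states.
    density-rational : ∀ s → IsRational (δ s)
    density-rational s = finite-state-limit-rational (λ s l → s ⊛ M q d l) r
      (λ k s → f s (dilateᵏ k)) (λ k s → f-dilate s (dilateᵏ k)) (allVecs d 5) ∈-allVecs s {δ s}
      (⇝-reindex {f s} {δ s} dilateᵏ k≤dilateᵏ (density s))

γ-zero : ∀ N q d → γ N q (suc d) (Vec.map rep (Vec.replicate 5 (Fin.zero {d}))) ≡ N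
γ-zero N q d = trans
  (cong length (Listₚ.filter-all (λ n → ℤ.+ suc d ℤ∣.∣? form q (Vec.map rep (Vec.replicate 5 (Fin.zero {d}))) n)
    -- With all coefficients zero the form computes to 0, so every n is counted.
    (All.universal (λ n → ℤ∣.divides (ℤ.+ 0) refl) (upTo N))))
  (Listₚ.length-upTo N)

n/n≡1 : ∀ n → ℤ.+ suc n ℚ./ suc n ≡ 1ℚ
n/n≡1 n = ℚₚ.fromℚᵘ-cong {mkℚᵘ (ℤ.+ suc n) n} {mkℚᵘ (ℤ.+ 1) 0} (*≡* (ℤₚ.*-comm (ℤ.+ suc n) (ℤ.+ 1)))

-- An eigenvector must be nonzero. At the zero state every frequency equals 1, so the density there
-- cannot be 0.
density-nonzero : ∀ q d .{{_ : NonZero d}} (δ : State d → ℝ) → (∀ s → IsDensity q d s (δ s)) → ¬ (∀ s → δ s ≃ 0ᴿ)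
density-nonzero q (suc d) δ density δ≃0 = 1≢0 (null-const (null-cong eq
  (null-+ (⟶⇒⇝ {λ k → ℤ.+ γ (suc k) q (suc d) (Vec.map rep s) ℚ./ suc k} {δ s} (density s)) (δ≃0 s))))
  where
  s = Vec.replicate 5 (Fin.zero {d})
  1≢0 : 1ℚ ≢ 0ℚ
  1≢0 ()
  open +-*-Solver
  lem : ∀ f x → f ℚ.- x ℚ.+ (x ℚ.- 0ℚ) ≡ f
  lem = solve 2 (λ f x → f :- x :+ (x :- con 0ℚ) := f) refl
  eq : ∀ k → ℤ.+ γ (suc k) q (suc d) (Vec.map rep s) ℚ./ suc k ℚ.- seq (δ s) k ℚ.+ (seq (δ s) k ℚ.- 0ℚ) ≡ 1ℚ
  eq k = trans (lem (ℤ.+ γ (suc k) q (suc d) (Vec.map rep s) ℚ./ suc k) (seq (δ s) k))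
    (trans (ℚₚ./-cong (cong ℤ.+_ (γ-zero (suc k) q d)) refl) (n/n≡1 k))

theorem2p6 : (q d : ℕ) .{{_ : NonZero q}} .{{_ : NonZero d}} →
    2 ≤ q → 2 ≤ d →
    (δ : State d → ℝ) → (∀ s → IsDensity q d s (δ s)) →
    (∀ s → (P q d ·ᵛ δ) s ≃ δ s) ×
    (¬ (∀ s → δ s ≃ 0ᴿ)) ×
    (∀ s → IsRational (δ s))
theorem2p6 q d {{q≢0}} {{d≢0}} 2≤q _ δ density =
  P-fixes-density {{q≢0}} {{d≢0}} 2≤q f f-dilate δ lim ,
  density-nonzero q d {{d≢0}} δ density ,
  density-rational {{q≢0}} {{d≢0}} 2≤q f f-dilate δ lim
  where
  f = frequency {{q≢0}} {{d≢0}} 2≤q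
  f-dilate = frequency-dilate {{q≢0}} {{d≢0}} 2≤q
  lim : ∀ s → f s ⇝ δ s
  lim s = ⟶⇒⇝ {f s} {δ s} (density s)
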